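{- For every pair $(k,\ell)$ of positive integers and every prime power $q$, there are only finitely many (up to isomorphism) simple, cosimple, $GF(q)$-representable matroids that are $(k,\ell)$-uniform.
   Context: For positive integers $k,\ell$, a matroid is called $(k,\ell)$-uniform if it has no minor isomorphic to $U_{k,k}\oplus U_{0,\ell}$ (the direct sum of a $k$-element free matroid and $\ell$ loops). A matroid is cosimple if its dual is simple. -}

module Defs where

open import Algebra.Apartness.Bundles using (HeytingField; module HeytingCommutativeRing)
open import Algebra.Bundles using (CommutativeRing)
import Algebra.Definitions.RawMonoid as RawMonoidDefs
open import Data.Bool.Base using (not; _∧_; _∨_)
open import Data.Fin.Base using (Fin; zero; suc)
open import Data.Fin.Permutation using (Permutation; _⟨$⟩ʳ_)
open import Data.Fin.Subset
open import Data.Fin.Subset.Properties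
open import Data.List.Base using (List)
open import Data.List.Relation.Unary.Any using (Any)
open import Data.Nat.Base using (ℕ; zero; suc; _+_; _∸_; _^_; _⊓_; _≤_; _≥_)
open import Data.Nat.Primality using (Prime)
open import Data.Nat.Properties
open import Data.Product.Base using (Σ; ∃; ∃₂; _×_; _,_; proj₂)
open import Data.Sum.Base using (inj₁; inj₂; [_,_]′)
open import Data.Vec.Base using (Vec; here; []; _∷_; lookup; tabulate; insertAt; take; drop; zipWith)
open import Data.Vec.Properties using (take-zipWith; drop-zipWith)
open import Function.Base using (id)
open import Function.Bundles using (Bijection; _⇔_)
open import Level using (Level; _⊔_)
open import Relation.Binary.PropositionalEquality
  using (_≡_; _≢_; refl; sym; trans; cong; cong₂; subst; module ≡-Reasoning)
  renaming (setoid to ≡-setoid)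
open import Relation.Nullary using (¬_)
open import Relation.Nullary.Decidable using (yes; no)

private
  variable
    m n : ℕ

private
  +-interchange : ∀ a b c d → (a + b) + (c + d) ≡ (a + c) + (b + d)
  +-interchange a b c d = begin
    (a + b) + (c + d) ≡⟨ +-assoc a b (c + d) ⟩
    a + (b + (c + d)) ≡⟨ cong (a +_) (sym (+-assoc b c d)) ⟩
    a + ((b + c) + d) ≡⟨ cong (λ z → a + (z + d)) (+-comm b c) ⟩
    a + ((c + b) + d) ≡⟨ cong (a +_) (+-assoc c b d) ⟩
    a + (c + (b + d)) ≡⟨ sym (+-assoc a c (b + d)) ⟩
    (a + c) + (b + d) ∎
    where open ≡-Reasoning

  ∸-pair : ∀ {a b c d} t → t ≤ a → t ≤ b → t ≤ c → t ≤ d →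
           a + b ≤ c + d → (a ∸ t) + (b ∸ t) ≤ (c ∸ t) + (d ∸ t)
  ∸-pair {a} {b} {c} {d} t ta tb tc td le =
    +-cancelʳ-≤ (t + t) _ _
      (subst (λ z → z ≤ (c ∸ t) + (d ∸ t) + (t + t)) (sym (fill ta tb))
        (subst (a + b ≤_) (sym (fill tc td)) le))
    where
    fill : ∀ {x y} → t ≤ x → t ≤ y → (x ∸ t) + (y ∸ t) + (t + t) ≡ x + y
    fill {x} {y} tx ty =
      trans (+-interchange (x ∸ t) (y ∸ t) t t) (cong₂ _+_ (m∸n+n≡m tx) (m∸n+n≡m ty))

  ∣∪∣+∣∩∣ : (X Y : Subset n) → ∣ X ∪ Y ∣ + ∣ X ∩ Y ∣ ≡ ∣ X ∣ + ∣ Y ∣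
  ∣∪∣+∣∩∣ []            []            = refl
  ∣∪∣+∣∩∣ (inside ∷ X)  (inside ∷ Y)  =
    cong suc (trans (+-suc _ _) (trans (cong suc (∣∪∣+∣∩∣ X Y)) (sym (+-suc _ _))))
  ∣∪∣+∣∩∣ (inside ∷ X)  (outside ∷ Y) = cong suc (∣∪∣+∣∩∣ X Y)
  ∣∪∣+∣∩∣ (outside ∷ X) (inside ∷ Y)  = trans (cong suc (∣∪∣+∣∩∣ X Y)) (sym (+-suc _ _))
  ∣∪∣+∣∩∣ (outside ∷ X) (outside ∷ Y) = ∣∪∣+∣∩∣ X Y

  ∣p∣+∣q∩∁p∣≡∣q∣ : (X Y : Subset n) → X ⊆ Y → ∣ X ∣ + ∣ Y ∩ ∁ X ∣ ≡ ∣ Y ∣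
  ∣p∣+∣q∩∁p∣≡∣q∣ []            []            _   = refl
  ∣p∣+∣q∩∁p∣≡∣q∣ (outside ∷ X) (outside ∷ Y) X⊆Y = ∣p∣+∣q∩∁p∣≡∣q∣ X Y (drop-∷-⊆ X⊆Y)
  ∣p∣+∣q∩∁p∣≡∣q∣ (outside ∷ X) (inside ∷ Y)  X⊆Y =
    trans (+-suc _ _) (cong suc (∣p∣+∣q∩∁p∣≡∣q∣ X Y (drop-∷-⊆ X⊆Y)))
  ∣p∣+∣q∩∁p∣≡∣q∣ (inside ∷ X)  (inside ∷ Y)  X⊆Y =
    cong suc (∣p∣+∣q∩∁p∣≡∣q∣ X Y (drop-∷-⊆ X⊆Y))
  ∣p∣+∣q∩∁p∣≡∣q∣ (inside ∷ X)  (outside ∷ Y) X⊆Y with () ← X⊆Y here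

  ∁-∪ : (X Y : Subset n) → ∁ (X ∪ Y) ≡ ∁ X ∩ ∁ Y
  ∁-∪ []            []      = refl
  ∁-∪ (inside ∷ X)  (y ∷ Y) = cong (outside ∷_) (∁-∪ X Y)
  ∁-∪ (outside ∷ X) (y ∷ Y) = cong (not y ∷_) (∁-∪ X Y)

  ∁-∩ : (X Y : Subset n) → ∁ (X ∩ Y) ≡ ∁ X ∪ ∁ Y
  ∁-∩ []            []      = refl
  ∁-∩ (inside ∷ X)  (y ∷ Y) = cong (not y ∷_) (∁-∩ X Y)
  ∁-∩ (outside ∷ X) (y ∷ Y) = cong (inside ∷_) (∁-∩ X Y)

  ∪-hom-mono : (f : Subset m → Subset n) → (∀ X Y → f (X ∪ Y) ≡ f X ∪ f Y) →
               ∀ {X Y} → X ⊆ Y → f X ⊆ f Y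
  ∪-hom-mono f f-∪ {X} {Y} X⊆Y =
    subst (λ Z → f X ⊆ Z)
      (trans (sym (f-∪ X Y))
             (cong f (⊆-antisym (λ x∈ → [ X⊆Y , id ]′ (x∈p∪q⁻ X Y x∈)) (q⊆p∪q X Y))))
      (p⊆p∪q (f Y))

  insertAt-zipWith : ∀ {A : Set} (f : A → A → A) (xs ys : Vec A n) e a b →
                     insertAt (zipWith f xs ys) e (f a b)
                       ≡ zipWith f (insertAt xs e a) (insertAt ys e b)
  insertAt-zipWith f xs       ys       zero    a b = refl
  insertAt-zipWith f (x ∷ xs) (y ∷ ys) (suc e) a b =
    cong (f x y ∷_) (insertAt-zipWith f xs ys e a b)

  ∣insertAt-outside∣ : (X : Subset n) (e : Fin (suc n)) → ∣ insertAt X e outside ∣ ≡ ∣ X ∣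
  ∣insertAt-outside∣ X             zero    = refl
  ∣insertAt-outside∣ (inside ∷ X)  (suc e) = cong suc (∣insertAt-outside∣ X e)
  ∣insertAt-outside∣ (outside ∷ X) (suc e) = ∣insertAt-outside∣ X e

  insertAt-⊥ : (e : Fin (suc n)) → insertAt ⊥ e inside ≡ ⁅ e ⁆
  insertAt-⊥ {n}     zero    = refl
  insertAt-⊥ {suc n} (suc e) = cong (outside ∷_) (insertAt-⊥ e)

  insertAt-inside : (X : Subset n) (e : Fin (suc n)) →
                    insertAt X e inside ≡ insertAt X e outside ∪ ⁅ e ⁆
  insertAt-inside {n} X e = begin
    insertAt X e inside                        ≡⟨ cong (λ Z → insertAt Z e inside) (sym (∪-identityʳ X)) ⟩
    insertAt (X ∪ ⊥) e inside                  ≡⟨ insertAt-zipWith _∨_ X ⊥ e outside inside ⟩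
    insertAt X e outside ∪ insertAt ⊥ e inside ≡⟨ cong (insertAt X e outside ∪_) (insertAt-⊥ e) ⟩
    insertAt X e outside ∪ ⁅ e ⁆               ∎
    where open ≡-Reasoning

  ∣take∣+∣drop∣ : ∀ m (X : Subset (m + n)) → ∣ take m X ∣ + ∣ drop m X ∣ ≡ ∣ X ∣
  ∣take∣+∣drop∣ zero    X             = refl
  ∣take∣+∣drop∣ (suc m) (inside ∷ X)  = cong suc (∣take∣+∣drop∣ m X)
  ∣take∣+∣drop∣ (suc m) (outside ∷ X) = ∣take∣+∣drop∣ m X

-- The ground set is Fin n, and the axioms are those of the rank function.
record Matroid (n : ℕ) : Set where
  field
    rank            : Subset n → ℕ
    rank≤size       : ∀ X → rank X ≤ ∣ X ∣
    rank-mono       : ∀ {X Y} → X ⊆ Y → rank X ≤ rank Y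
    rank-submodular : ∀ X Y → rank (X ∪ Y) + rank (X ∩ Y) ≤ rank X + rank Y

  Independent : Subset n → Set
  Independent X = rank X ≡ ∣ X ∣

  Circuit : Subset n → Set
  Circuit C = ¬ Independent C × (∀ X → X ⊂ C → Independent X)

  Loop : Fin n → Set
  Loop e = Circuit ⁅ e ⁆

  Parallel : Fin n → Fin n → Set
  Parallel e f = e ≢ f × Circuit (⁅ e ⁆ ∪ ⁅ f ⁆)

  Simple : Set
  Simple = (∀ e → ¬ Loop e) × (∀ e f → ¬ Parallel e f)

  rank-subadditive : ∀ X Y → rank (X ∪ Y) ≤ rank X + rank Y
  rank-subadditive X Y = ≤-trans (m≤m+n _ _) (rank-submodular X Y)

open Matroid public using (Simple)

dual : Matroid n → Matroid n
dual {n} M = record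
  { rank            = rank*
  ; rank≤size       = λ X → ≤-trans (rank*≤ X) (≤-reflexive (m+n∸n≡m ∣ X ∣ (rank ⊤)))
  ; rank-mono       = λ {X} {Y} X⊆Y → ∸-monoˡ-≤ (rank ⊤) (corank-mono X Y X⊆Y)
  ; rank-submodular = λ X Y →
      ∸-pair (rank ⊤) (⊤≤ (X ∪ Y)) (⊤≤ (X ∩ Y)) (⊤≤ X) (⊤≤ Y) (corank-submodular X Y)
  }
  where
  open Matroid M
  open ≤-Reasoning

  rank* : Subset n → ℕ
  rank* X = (∣ X ∣ + rank (∁ X)) ∸ rank ⊤

  rank*≤ : ∀ X → rank* X ≤ (∣ X ∣ + rank ⊤) ∸ rank ⊤
  rank*≤ X = ∸-monoˡ-≤ (rank ⊤) (+-monoʳ-≤ ∣ X ∣ (rank-mono ⊆⊤))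

  ⊤≤ : ∀ X → rank ⊤ ≤ ∣ X ∣ + rank (∁ X)
  ⊤≤ X = begin
    rank ⊤              ≡⟨ cong rank (sym (p∪∁p≡⊤ X)) ⟩
    rank (X ∪ ∁ X)      ≤⟨ rank-subadditive X (∁ X) ⟩
    rank X + rank (∁ X) ≤⟨ +-monoˡ-≤ _ (rank≤size X) ⟩
    ∣ X ∣ + rank (∁ X)  ∎

  ∁-split : ∀ X Y → ∁ X ⊆ (Y ∩ ∁ X) ∪ ∁ Y
  ∁-split X Y {x} x∈ with x ∈? Y
  ... | yes x∈Y = x∈p∪q⁺ (inj₁ (x∈p∩q⁺ (x∈Y , x∈)))
  ... | no  x∉Y = x∈p∪q⁺ (inj₂ (x∉p⇒x∈∁p x∉Y))

  corank-mono : ∀ X Y → X ⊆ Y → ∣ X ∣ + rank (∁ X) ≤ ∣ Y ∣ + rank (∁ Y)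
  corank-mono X Y X⊆Y = begin
    ∣ X ∣ + rank (∁ X)                      ≤⟨ +-monoʳ-≤ ∣ X ∣ (rank-mono (∁-split X Y)) ⟩
    ∣ X ∣ + rank ((Y ∩ ∁ X) ∪ ∁ Y)          ≤⟨ +-monoʳ-≤ ∣ X ∣ (rank-subadditive _ _) ⟩
    ∣ X ∣ + (rank (Y ∩ ∁ X) + rank (∁ Y))   ≤⟨ +-monoʳ-≤ ∣ X ∣ (+-monoˡ-≤ _ (rank≤size _)) ⟩
    ∣ X ∣ + (∣ Y ∩ ∁ X ∣ + rank (∁ Y))      ≡⟨ sym (+-assoc ∣ X ∣ _ _) ⟩
    (∣ X ∣ + ∣ Y ∩ ∁ X ∣) + rank (∁ Y)      ≡⟨ cong (_+ rank (∁ Y)) (∣p∣+∣q∩∁p∣≡∣q∣ X Y X⊆Y) ⟩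
    ∣ Y ∣ + rank (∁ Y)                      ∎

  corank-submodular : ∀ X Y →
    (∣ X ∪ Y ∣ + rank (∁ (X ∪ Y))) + (∣ X ∩ Y ∣ + rank (∁ (X ∩ Y)))
      ≤ (∣ X ∣ + rank (∁ X)) + (∣ Y ∣ + rank (∁ Y))
  corank-submodular X Y = begin
    (∣ X ∪ Y ∣ + rank (∁ (X ∪ Y))) + (∣ X ∩ Y ∣ + rank (∁ (X ∩ Y)))
      ≡⟨ +-interchange (∣ X ∪ Y ∣) _ (∣ X ∩ Y ∣) _ ⟩
    (∣ X ∪ Y ∣ + ∣ X ∩ Y ∣) + (rank (∁ (X ∪ Y)) + rank (∁ (X ∩ Y)))
      ≡⟨ cong₂ _+_ (∣∪∣+∣∩∣ X Y)
           (trans (cong₂ (λ A B → rank A + rank B) (∁-∪ X Y) (∁-∩ X Y)) (+-comm (rank (∁ X ∩ ∁ Y)) _)) ⟩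
    (∣ X ∣ + ∣ Y ∣) + (rank (∁ X ∪ ∁ Y) + rank (∁ X ∩ ∁ Y))
      ≤⟨ +-monoʳ-≤ (∣ X ∣ + ∣ Y ∣) (rank-submodular (∁ X) (∁ Y)) ⟩
    (∣ X ∣ + ∣ Y ∣) + (rank (∁ X) + rank (∁ Y))
      ≡⟨ +-interchange (∣ X ∣) (∣ Y ∣) _ _ ⟩
    (∣ X ∣ + rank (∁ X)) + (∣ Y ∣ + rank (∁ Y)) ∎

Cosimple : Matroid n → Set
Cosimple M = Simple (dual M)

-- In `M ⧵ e` and `M ╱ e` the n elements other than e are renumbered by Fin n,
-- keeping their order, so a subset X of the smaller ground set corresponds to
-- `insertAt X e outside`, and X ∪ {e} to `insertAt X e inside`.

infixl 8 _⧵_ _╱_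

_⧵_ : Matroid (suc n) → Fin (suc n) → Matroid n
_⧵_ {n} M e = record
  { rank            = λ X → rank (ins X)
  ; rank≤size       = λ X → ≤-trans (rank≤size _) (≤-reflexive (∣insertAt-outside∣ X e))
  ; rank-mono       = λ X⊆Y →
      rank-mono (∪-hom-mono ins (λ X Y → insertAt-zipWith _∨_ X Y e _ _) X⊆Y)
  ; rank-submodular = λ X Y →
      ≤-trans (≤-reflexive (cong₂ (λ A B → rank A + rank B)
                (insertAt-zipWith _∨_ X Y e outside outside)
                (insertAt-zipWith _∧_ X Y e outside outside)))
              (rank-submodular (ins X) (ins Y))
  }
  where
  open Matroid M
  ins : Subset n → Subset (suc n)
  ins X = insertAt X e outside

_╱_ : Matroid (suc n) → Fin (suc n) → Matroid n
_╱_ {n} M e = record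
  { rank            = λ X → rank (ins X) ∸ rank ⁅ e ⁆
  ; rank≤size       = λ X →
      ≤-trans (∸-monoˡ-≤ (rank ⁅ e ⁆) (bound X)) (≤-reflexive (m+n∸n≡m ∣ X ∣ (rank ⁅ e ⁆)))
  ; rank-mono       = λ X⊆Y → ∸-monoˡ-≤ (rank ⁅ e ⁆) (rank-mono (∪-hom-mono ins ins-∪ X⊆Y))
  ; rank-submodular = λ X Y →
      ∸-pair (rank ⁅ e ⁆) (e≤ (X ∪ Y)) (e≤ (X ∩ Y)) (e≤ X) (e≤ Y)
        (≤-trans (≤-reflexive (cong₂ (λ A B → rank A + rank B)
                   (ins-∪ X Y) (insertAt-zipWith _∧_ X Y e inside inside)))
                 (rank-submodular (ins X) (ins Y)))
  }
  where
  open Matroid M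
  open ≤-Reasoning

  ins : Subset n → Subset (suc n)
  ins X = insertAt X e inside

  ins-∪ : ∀ X Y → ins (X ∪ Y) ≡ ins X ∪ ins Y
  ins-∪ X Y = insertAt-zipWith _∨_ X Y e inside inside

  e≤ : ∀ X → rank ⁅ e ⁆ ≤ rank (ins X)
  e≤ X = rank-mono (subst (⁅ e ⁆ ⊆_) (sym (insertAt-inside X e)) (q⊆p∪q _ ⁅ e ⁆))

  bound : ∀ X → rank (ins X) ≤ ∣ X ∣ + rank ⁅ e ⁆
  bound X = begin
    rank (ins X)                             ≡⟨ cong rank (insertAt-inside X e) ⟩
    rank (insertAt X e outside ∪ ⁅ e ⁆)      ≤⟨ rank-subadditive _ _ ⟩
    rank (insertAt X e outside) + rank ⁅ e ⁆ ≤⟨ +-monoˡ-≤ _ (rank≤size _) ⟩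
    ∣ insertAt X e outside ∣ + rank ⁅ e ⁆    ≡⟨ cong (_+ rank ⁅ e ⁆) (∣insertAt-outside∣ X e) ⟩
    ∣ X ∣ + rank ⁅ e ⁆                       ∎

data Minor (M : Matroid n) : ∀ {m} → Matroid m → Set where
  itself   : Minor M M
  delete   : ∀ {m} {N : Matroid (suc m)} → Minor M N → ∀ e → Minor M (N ⧵ e)
  contract : ∀ {m} {N : Matroid (suc m)} → Minor M N → ∀ e → Minor M (N ╱ e)

infix 4 _≅_

_≅_ : Matroid m → Matroid n → Set
_≅_ {m} {n} M N = Σ (Permutation m n) λ σ →
  ∀ X → Matroid.rank M (tabulate λ i → lookup X (σ ⟨$⟩ʳ i)) ≡ Matroid.rank N X

HasMinorIsomorphicTo : Matroid m → Matroid n → Set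
HasMinorIsomorphicTo N M = ∃₂ λ k (M′ : Matroid k) → Minor M M′ × M′ ≅ N

U : ∀ r n → Matroid n
U r n = record
  { rank            = λ X → ∣ X ∣ ⊓ r
  ; rank≤size       = λ X → m⊓n≤m ∣ X ∣ r
  ; rank-mono       = λ X⊆Y → ⊓-monoˡ-≤ r (p⊆q⇒∣p∣≤∣q∣ X⊆Y)
  ; rank-submodular = λ X Y →
      bound (≤-reflexive (∣∪∣+∣∩∣ X Y)) (∣p∩q∣≤∣p∣ X Y) (∣p∩q∣≤∣q∣ X Y)
  }
  where
  open ≤-Reasoning
  bound : ∀ {a b c d} → a + b ≤ c + d → b ≤ c → b ≤ d →
          (a ⊓ r) + (b ⊓ r) ≤ (c ⊓ r) + (d ⊓ r)
  bound {a} {b} {c} {d} le b≤c b≤d with ≤-total c r | ≤-total d r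
  ... | inj₁ c≤r | inj₁ d≤r = begin
    (a ⊓ r) + (b ⊓ r) ≤⟨ +-mono-≤ (m⊓n≤m a r) (m⊓n≤m b r) ⟩
    a + b             ≤⟨ le ⟩
    c + d             ≡⟨ cong₂ _+_ (sym (m≤n⇒m⊓n≡m c≤r)) (sym (m≤n⇒m⊓n≡m d≤r)) ⟩
    (c ⊓ r) + (d ⊓ r) ∎
  ... | inj₂ r≤c | _ = begin
    (a ⊓ r) + (b ⊓ r) ≤⟨ +-mono-≤ (m⊓n≤n a r) (⊓-monoˡ-≤ r b≤d) ⟩
    r + (d ⊓ r)       ≡⟨ cong (_+ (d ⊓ r)) (sym (m≥n⇒m⊓n≡n r≤c)) ⟩
    (c ⊓ r) + (d ⊓ r) ∎
  ... | inj₁ _ | inj₂ r≤d = begin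
    (a ⊓ r) + (b ⊓ r) ≡⟨ +-comm (a ⊓ r) (b ⊓ r) ⟩
    (b ⊓ r) + (a ⊓ r) ≤⟨ +-mono-≤ (⊓-monoˡ-≤ r b≤c) (m⊓n≤n a r) ⟩
    (c ⊓ r) + r       ≡⟨ cong ((c ⊓ r) +_) (sym (m≥n⇒m⊓n≡n r≤d)) ⟩
    (c ⊓ r) + (d ⊓ r) ∎

infixl 6 _⊕_

_⊕_ : Matroid m → Matroid n → Matroid (m + n)
_⊕_ {m} {n} M N = record
  { rank            = λ X → M.rank (take m X) + N.rank (drop m X)
  ; rank≤size       = λ X →
      ≤-trans (+-mono-≤ (M.rank≤size _) (N.rank≤size _)) (≤-reflexive (∣take∣+∣drop∣ m X))
  ; rank-mono       = λ X⊆Y →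
      +-mono-≤ (M.rank-mono (∪-hom-mono (take m) (take-zipWith _∨_) X⊆Y))
               (N.rank-mono (∪-hom-mono (drop m) (drop-zipWith _∨_) X⊆Y))
  ; rank-submodular = submodular
  }
  where
  module M = Matroid M
  module N = Matroid N
  open ≤-Reasoning

  submodular : ∀ X Y →
    (M.rank (take m (X ∪ Y)) + N.rank (drop m (X ∪ Y)))
      + (M.rank (take m (X ∩ Y)) + N.rank (drop m (X ∩ Y)))
      ≤ (M.rank (take m X) + N.rank (drop m X)) + (M.rank (take m Y) + N.rank (drop m Y))
  submodular X Y
    rewrite take-zipWith {m = m} _∨_ X Y | drop-zipWith {m = m} _∨_ X Y
          | take-zipWith {m = m} _∧_ X Y | drop-zipWith {m = m} _∧_ X Y = begin
    (M.rank (X₁ ∪ Y₁) + N.rank (X₂ ∪ Y₂)) + (M.rank (X₁ ∩ Y₁) + N.rank (X₂ ∩ Y₂))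
      ≡⟨ +-interchange (M.rank (X₁ ∪ Y₁)) _ _ _ ⟩
    (M.rank (X₁ ∪ Y₁) + M.rank (X₁ ∩ Y₁)) + (N.rank (X₂ ∪ Y₂) + N.rank (X₂ ∩ Y₂))
      ≤⟨ +-mono-≤ (M.rank-submodular X₁ Y₁) (N.rank-submodular X₂ Y₂) ⟩
    (M.rank X₁ + M.rank Y₁) + (N.rank X₂ + N.rank Y₂)
      ≡⟨ +-interchange (M.rank X₁) _ _ _ ⟩
    (M.rank X₁ + N.rank X₂) + (M.rank Y₁ + N.rank Y₂) ∎
    where
    X₁ Y₁ : Subset m
    X₁ = take m X
    Y₁ = take m Y
    X₂ Y₂ : Subset n
    X₂ = drop m X
    Y₂ = drop m Y

Uniform : ℕ → ℕ → Matroid n → Set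
Uniform k ℓ M = ¬ HasMinorIsomorphicTo (U k k ⊕ U 0 ℓ) M

PrimePower : ℕ → Set
PrimePower q = ∃₂ λ p a → Prime p × a ≥ 1 × q ≡ p ^ a

-- When the carrier is finite, as it is under `HasOrder F q`, equality and
-- invertibility are decidable, so x # y is equivalent to ¬ (x ≈ y) and a
-- Heyting field is just a field. GF(q) is then any F with `HasOrder F q`.

module _ {c ℓ₁ ℓ₂ : Level} (F : HeytingField c ℓ₁ ℓ₂) where

  private
    ring : CommutativeRing c ℓ₁
    ring = HeytingCommutativeRing.commutativeRing (HeytingField.heytingCommutativeRing F)

  open CommutativeRing ring hiding (_+_; ring; sym; trans; refl)
  open RawMonoidDefs +-rawMonoid using (sum)

  HasOrder : ℕ → Set (c ⊔ ℓ₁)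
  HasOrder q = Bijection setoid (≡-setoid (Fin q))

  LinearlyIndependentColumns : ∀ {d} → (Fin d → Fin n → Carrier) → Subset n → Set (c ⊔ ℓ₁)
  LinearlyIndependentColumns {n} A X =
    (a : Fin n → Carrier) → (∀ j → j ∉ X → a j ≈ 0#) →
    (∀ i → sum (λ j → a j * A i j) ≈ 0#) → ∀ j → a j ≈ 0#

  Representable : Matroid n → Set (c ⊔ ℓ₁)
  Representable {n} M = ∃₂ λ d (A : Fin d → Fin n → Carrier) →
    ∀ X → Matroid.Independent M X ⇔ LinearlyIndependentColumns A X

-- A finite list that meets every isomorphism class of P; its members need not
-- all satisfy P.
FinitelyManyUpToIsomorphism : ∀ {a} → (∀ {n} → Matroid n → Set a) → Set a
FinitelyManyUpToIsomorphism P =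
  Σ (List (∃ Matroid)) λ L → ∀ {n} (M : Matroid n) → P M → Any (λ N → M ≅ proj₂ N) L

{-# OPTIONS --safe #-}

-- A set X with r(X) + ℓ ≤ |X| and r(X) + k ≤ r(M) yields the forbidden minor.
-- Let B be a basis. For f ∉ B the fundamental circuit of B ∪ {f} is the support
-- of a kernel vector v_f of the representing matrix. If all v_t with t ∈ T ⊆ ∁B
-- are constant on H ⊆ B, then r((B ∖ H) ∪ T) ≤ |B ∖ H| + 1. Colouring e ∈ B by
-- (v_t(e))_{t ∈ T} and applying the pigeonhole principle gives:
--   * |B| ≤ q^|∁B|, as otherwise (T = ∁B, |H| = 2) two elements are in series;
--   * |B| ≤ k q^(ℓ+1) if |∁B| > ℓ, as otherwise (|T| = ℓ + 1, |H| = k + 1) the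
--     set (B ∖ H) ∪ T has nullity at least ℓ and corank at least k.
-- Colouring f ∈ ∁B by (v_f(b))_{b ∈ B} gives |∁B| ≤ q^|B|, as otherwise two
-- elements are parallel. Hence the size of M is bounded in terms of k, ℓ and q.

module Submission where

open import Algebra.Apartness.Bundles using (HeytingField; module HeytingCommutativeRing)
import Algebra.Apartness.Properties.HeytingCommutativeRing as HeytingCommutativeRingProperties
open import Algebra.Bundles using (CommutativeRing)
import Algebra.Properties.Ring as RingProperties
import Algebra.Properties.Semiring.Sum as SemiringSum
open import Data.Bool.Base using (not; _∧_)
open import Data.Fin.Base using (Fin; zero; suc; toℕ; join; _↑ˡ_; finToFun; funToFin)
import Data.Fin.Permutation as Permutation
open import Data.Fin.Permutation using (Permutation; _⟨$⟩ʳ_)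
open import Data.Fin.Properties
  using (any?; all?; toℕ<n; toℕ-injective; +↔⊎; finToFun-funToFin; nonZeroIndex)
  renaming (_≟_ to _≟ᶠ_)
open import Data.Fin.Subset hiding (_-_)
open import Data.Fin.Subset.Properties
open import Data.List.Base as List using (List; []; _∷_; upTo; concatMap; cartesianProductWith)
open import Data.List.Membership.Propositional using (lose)
open import Data.List.Membership.Propositional.Properties using (∈-upTo⁺)
open import Data.List.Relation.Unary.Any as Any using (Any; here)
import Data.List.Relation.Unary.Any.Properties as Any
open import Data.Nat.Base
  using (ℕ; zero; suc; _+_; _*_; _∸_; _^_; _⊓_; _≤_; _<_; _≥_; z≤n; s≤s; s≤s⁻¹; NonZero)
open import Data.Nat.Properties
open import Data.Product.Base using (∃; ∃₂; _×_; _,_; proj₁; proj₂)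
open import Data.Sum.Base using (_⊎_; inj₁; inj₂; [_,_]′; map₁; map₂)
open import Data.Vec.Base
  using (Vec; []; _∷_; here; there; tabulate; take; drop; lookup; insertAt; removeAt; zipWith)
open import Data.Vec.Properties
  using (lookup⇒[]=; []=⇒lookup; lookup∘tabulate; tabulate∘lookup; map-insertAt; insertAt-removeAt)
open import Function.Base using (id; _∘_; const)
open import Function.Bundles using (Bijection; Equivalence; _⇔_; mk↔ₛ′)
open import Function.Properties.Inverse using (↔-trans; ↔-sym)
open import Level using (Level)
open import Relation.Binary.PropositionalEquality
  using (_≡_; _≢_; refl; sym; trans; cong; cong₂; subst; subst₂; _≗_; module ≡-Reasoning)
import Relation.Binary.Reasoning.Setoid as SetoidReasoning
open import Relation.Nullary using (¬_; yes; no; Dec; does; contradiction)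
open import Relation.Nullary.Decidable using (_×-dec_; _→-dec_; ¬?; dec-true; map′; decidable-stable)
open import Defs

private
  variable
    m n : ℕ

-- Subsets of a finite set

∣p∩q∣+∣p∩∁q∣≡∣p∣ : (p q : Subset n) → ∣ p ∩ q ∣ + ∣ p ∩ ∁ q ∣ ≡ ∣ p ∣
∣p∩q∣+∣p∩∁q∣≡∣p∣ []            []            = refl
∣p∩q∣+∣p∩∁q∣≡∣p∣ (outside ∷ p) (_ ∷ q)       = ∣p∩q∣+∣p∩∁q∣≡∣p∣ p q
∣p∩q∣+∣p∩∁q∣≡∣p∣ (inside ∷ p)  (inside ∷ q)  = cong suc (∣p∩q∣+∣p∩∁q∣≡∣p∣ p q)
∣p∩q∣+∣p∩∁q∣≡∣p∣ (inside ∷ p)  (outside ∷ q) =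
  trans (+-suc _ _) (cong suc (∣p∩q∣+∣p∩∁q∣≡∣p∣ p q))

∣p∣+∣∁p∣≡n : (p : Subset n) → ∣ p ∣ + ∣ ∁ p ∣ ≡ n
∣p∣+∣∁p∣≡n p = trans (cong (∣ p ∣ +_) (∣∁p∣≡n∸∣p∣ p)) (m+[n∸m]≡n (∣p∣≤n p))

∣p∪q∣≤∣p∣+∣q∣ : (p q : Subset n) → ∣ p ∪ q ∣ ≤ ∣ p ∣ + ∣ q ∣
∣p∪q∣≤∣p∣+∣q∣ p q = begin
  ∣ p ∪ q ∣                                 ≡⟨ ∣p∩q∣+∣p∩∁q∣≡∣p∣ (p ∪ q) p ⟨
  ∣ (p ∪ q) ∩ p ∣ + ∣ (p ∪ q) ∩ ∁ p ∣       ≤⟨ +-mono-≤ (∣p∩q∣≤∣q∣ (p ∪ q) p) (p⊆q⇒∣p∣≤∣q∣ rest) ⟩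
  ∣ p ∣ + ∣ q ∣                             ∎
  where
  open ≤-Reasoning
  rest : (p ∪ q) ∩ ∁ p ⊆ q
  rest x∈ with x∈p∪q , x∈∁p ← x∈p∩q⁻ (p ∪ q) (∁ p) x∈ =
    [ (λ x∈p → contradiction x∈p (x∈∁p⇒x∉p x∈∁p)) , id ]′ (x∈p∪q⁻ p q x∈p∪q)

∣p∣+∣q∣≤∣p∪q∣ : (p q : Subset n) → (∀ {x} → x ∈ p → x ∉ q) → ∣ p ∣ + ∣ q ∣ ≤ ∣ p ∪ q ∣
∣p∣+∣q∣≤∣p∪q∣ p q disjoint = begin
  ∣ p ∣ + ∣ q ∣                         ≤⟨ +-mono-≤ (p⊆q⇒∣p∣≤∣q∣ left) (p⊆q⇒∣p∣≤∣q∣ right) ⟩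
  ∣ (p ∪ q) ∩ p ∣ + ∣ (p ∪ q) ∩ ∁ p ∣   ≡⟨ ∣p∩q∣+∣p∩∁q∣≡∣p∣ (p ∪ q) p ⟩
  ∣ p ∪ q ∣                             ∎
  where
  open ≤-Reasoning
  left : p ⊆ (p ∪ q) ∩ p
  left x∈p = x∈p∩q⁺ (p⊆p∪q q x∈p , x∈p)
  right : q ⊆ (p ∪ q) ∩ ∁ p
  right x∈q = x∈p∩q⁺ (q⊆p∪q p q x∈q , x∉p⇒x∈∁p (λ x∈p → disjoint x∈p x∈q))

∣p∪⁅x⁆∣≤1+∣p∣ : (p : Subset n) (x : Fin n) → ∣ p ∪ ⁅ x ⁆ ∣ ≤ suc ∣ p ∣
∣p∪⁅x⁆∣≤1+∣p∣ p x = begin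
  ∣ p ∪ ⁅ x ⁆ ∣     ≤⟨ ∣p∪q∣≤∣p∣+∣q∣ p ⁅ x ⁆ ⟩
  ∣ p ∣ + ∣ ⁅ x ⁆ ∣ ≡⟨ cong (∣ p ∣ +_) (∣⁅x⁆∣≡1 x) ⟩
  ∣ p ∣ + 1         ≡⟨ +-comm ∣ p ∣ 1 ⟩
  suc ∣ p ∣         ∎
  where open ≤-Reasoning

x∉p⇒∣p∣<∣p∪⁅x⁆∣ : (p : Subset n) {x : Fin n} → x ∉ p → ∣ p ∣ < ∣ p ∪ ⁅ x ⁆ ∣
x∉p⇒∣p∣<∣p∪⁅x⁆∣ p {x} x∉p =
  p⊂q⇒∣p∣<∣q∣ (p⊆p∪q ⁅ x ⁆ , x , q⊆p∪q p ⁅ x ⁆ (x∈⁅x⁆ x) , x∉p)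

∪⊆ : {p q r : Subset n} → p ⊆ r → q ⊆ r → p ∪ q ⊆ r
∪⊆ {p = p} {q} p⊆r q⊆r x∈ = [ p⊆r , q⊆r ]′ (x∈p∪q⁻ p q x∈)

∉∪ : {p q : Subset n} {x : Fin n} → x ∉ p → x ∉ q → x ∉ p ∪ q
∉∪ {p = p} {q} x∉p x∉q = [ x∉p , x∉q ]′ ∘ x∈p∪q⁻ p q

⁅⁆⊆ : {x : Fin n} {p : Subset n} → x ∈ p → ⁅ x ⁆ ⊆ p
⁅⁆⊆ {x = x} x∈p y∈ rewrite x∈⁅y⁆⇒x≡y x y∈ = x∈p

∪-monoˡ-⊆ : {p q : Subset n} (r : Subset n) → p ⊆ q → p ∪ r ⊆ q ∪ r
∪-monoˡ-⊆ {q = q} r p⊆q = ∪⊆ (p⊆p∪q r ∘ p⊆q) (q⊆p∪q q r)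

p⊆p∩∁q∪q : (p q : Subset n) → p ⊆ (p ∩ ∁ q) ∪ q
p⊆p∩∁q∪q p q {x} x∈p with x ∈? q
... | yes x∈q = q⊆p∪q (p ∩ ∁ q) q x∈q
... | no  x∉q = p⊆p∪q q (x∈p∩q⁺ (x∈p , x∉p⇒x∈∁p x∉q))

∪-∩-∁-∪ : {p q r s : Subset n} → p ⊆ s → r ⊆ s → q ⊆ ∁ s → (p ∪ q) ∩ ∁ (p ∪ r) ≡ q
∪-∩-∁-∪ {p = p} {q} {r} p⊆s r⊆s q⊆∁s = ⊆-antisym to from
  where
  to : (p ∪ q) ∩ ∁ (p ∪ r) ⊆ q
  to x∈ = let x∈p∪q , x∈∁ = x∈p∩q⁻ (p ∪ q) (∁ (p ∪ r)) x∈ in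
    [ (λ x∈p → contradiction (p⊆p∪q r x∈p) (x∈∁p⇒x∉p x∈∁)) , id ]′ (x∈p∪q⁻ p q x∈p∪q)
  from : q ⊆ (p ∪ q) ∩ ∁ (p ∪ r)
  from x∈q = x∈p∩q⁺ (q⊆p∪q p q x∈q , x∉p⇒x∈∁p (x∈∁p⇒x∉p (q⊆∁s x∈q) ∘ ∪⊆ p⊆s r⊆s))

x≢y⇒1<∣⁅x⁆∪⁅y⁆∣ : {x y : Fin n} → x ≢ y → 1 < ∣ ⁅ x ⁆ ∪ ⁅ y ⁆ ∣
x≢y⇒1<∣⁅x⁆∪⁅y⁆∣ {x = x} {y} x≢y =
  subst (_< ∣ ⁅ x ⁆ ∪ ⁅ y ⁆ ∣) (∣⁅x⁆∣≡1 x)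
    (x∉p⇒∣p∣<∣p∪⁅x⁆∣ ⁅ x ⁆ (λ y∈ → x≢y (sym (x∈⁅y⁆⇒x≡y x y∈))))

1≤∣p∣⇒Nonempty : (p : Subset n) → 1 ≤ ∣ p ∣ → Nonempty p
1≤∣p∣⇒Nonempty {n} p 1≤∣p∣ with nonempty? p
... | yes x∈p = x∈p
... | no  empty = contradiction (subst (λ q → 1 ≤ ∣ q ∣) (Empty-unique empty) 1≤∣p∣)
                    (subst (λ k → ¬ 1 ≤ k) (sym (∣⊥∣≡0 n)) (λ ()))

1<∣p∣⇒two-elements : (p : Subset n) → 1 < ∣ p ∣ → ∃₂ λ x y → x ≢ y × x ∈ p × y ∈ p
1<∣p∣⇒two-elements p 1<∣p∣ =
  let x , x∈p = 1≤∣p∣⇒Nonempty p (<⇒≤ 1<∣p∣)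
      y , y∈  = 1≤∣p∣⇒Nonempty (p ∩ ∁ ⁅ x ⁆) (s≤s⁻¹ (begin
        2                               ≤⟨ 1<∣p∣ ⟩
        ∣ p ∣                           ≤⟨ p⊆q⇒∣p∣≤∣q∣ (p⊆p∩∁q∪q p ⁅ x ⁆) ⟩
        ∣ (p ∩ ∁ ⁅ x ⁆) ∪ ⁅ x ⁆ ∣       ≤⟨ ∣p∪⁅x⁆∣≤1+∣p∣ (p ∩ ∁ ⁅ x ⁆) x ⟩
        suc ∣ p ∩ ∁ ⁅ x ⁆ ∣             ∎))
      y∈p , y∈∁x = x∈p∩q⁻ p (∁ ⁅ x ⁆) y∈
  in x , y , (λ x≡y → x∈∁p⇒x∉p y∈∁x (subst (_∈ ⁅ x ⁆) x≡y (x∈⁅x⁆ x))) , x∈p , y∈p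
  where open ≤-Reasoning

subset-of-size : ∀ s (p : Subset n) → s ≤ ∣ p ∣ → ∃ λ q → q ⊆ p × ∣ q ∣ ≡ s
subset-of-size {n} zero p            _  = ⊥ , ⊥⊆ , ∣⊥∣≡0 n
subset-of-size (suc s) (inside ∷ p)  le =
  let q , q⊆p , ∣q∣≡s = subset-of-size s p (s≤s⁻¹ le)
  in inside ∷ q , in⊆in q⊆p , cong suc ∣q∣≡s
subset-of-size (suc s) (outside ∷ p) le =
  let q , q⊆p , ∣q∣≡s = subset-of-size (suc s) p le
  in outside ∷ q , out⊆ q⊆p , ∣q∣≡s

-- Induction on the vector peels off the least index: `P ∘ (outside ∷_)` handles the subsets that
-- avoid `zero`, and one use of `step` adjoins it.
subset-rec : ∀ {a} (P : Subset n → Set a) → P ⊥ → (∀ x p → P p → P (⁅ x ⁆ ∪ p)) → ∀ p → P p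
subset-rec P base step []      = base
subset-rec P base step (s ∷ p) = add s (subset-rec (P ∘ (outside ∷_)) base (λ x q → step (suc x) (outside ∷ q)) p)
  where
  add : ∀ s → P (outside ∷ p) → P (s ∷ p)
  add outside Pp = Pp
  add inside  Pp = subst (λ q → P (inside ∷ q)) (∪-identityˡ p) (step zero (outside ∷ p) Pp)

⟪_⟫ : ∀ {a} {P : Fin n → Set a} → (∀ x → Dec (P x)) → Subset n
⟪ P? ⟫ = tabulate (does ∘ P?)

module _ {a} {P : Fin n → Set a} (P? : ∀ x → Dec (P x)) where

  ∈⟪⟫⁺ : ∀ {x} → P x → x ∈ ⟪ P? ⟫
  ∈⟪⟫⁺ {x} Px = lookup⇒[]= x ⟪ P? ⟫ (trans (lookup∘tabulate (does ∘ P?) x) (dec-true (P? x) Px))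

  ∈⟪⟫⁻ : ∀ {x} → x ∈ ⟪ P? ⟫ → P x
  ∈⟪⟫⁻ {x} x∈ with P? x | trans (sym (lookup∘tabulate (does ∘ P?) x)) ([]=⇒lookup x∈)
  ... | yes Px | _ = Px

-- Pigeonhole principles

Constant : ∀ {a} {A : Set a} → (Fin n → A) → Subset n → Set a
Constant g H = ∀ {x y} → x ∈ H → y ∈ H → g x ≡ g y

Constant-⊆ : ∀ {a} {A : Set a} {g : Fin n → A} {H K} → H ⊆ K → Constant g K → Constant g H
Constant-⊆ H⊆K const x∈ y∈ = const (H⊆K x∈) (H⊆K y∈)

-- Induction on the number of colours: either the last colour class has more than `m` elements, or
-- discarding it leaves more than `m * q` elements for the other `q` colours. Colours are natural
-- numbers bounded on `B`, so that the bound can drop when `B` shrinks.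
pigeonhole-ℕ : ∀ q (m : ℕ) (g : Fin n → ℕ) (B : Subset n) → (∀ {x} → x ∈ B → g x < q) →
               m * q < ∣ B ∣ → ∃ λ H → H ⊆ B × m < ∣ H ∣ × Constant g H
pigeonhole-ℕ zero    m g B g<q big
  with x , x∈B ← 1≤∣p∣⇒Nonempty B (subst (_< ∣ B ∣) (*-zeroʳ m) big)
  with () ← g<q x∈B
pigeonhole-ℕ (suc q) m g B g<q big with m <? ∣ B ∩ ⟪ (λ x → g x ≟ q) ⟫ ∣
... | yes m<∣H∣ =
  _ , p∩q⊆p B _ , m<∣H∣ ,
  λ x∈ y∈ → trans (gq x∈) (sym (gq y∈))
  where
  gq : ∀ {x} → x ∈ B ∩ ⟪ (λ x → g x ≟ q) ⟫ → g x ≡ q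
  gq x∈ = ∈⟪⟫⁻ (λ x → g x ≟ q) (p∩q⊆q B _ x∈)
... | no m≮∣H∣ =
  let H , H⊆ , m<∣H∣ , const = pigeonhole-ℕ q m g B′ g<q′ big′
  in H , p∩q⊆p B _ ∘ H⊆ , m<∣H∣ , const
  where
  Q B′ : Subset _
  Q  = ⟪ (λ x → g x ≟ q) ⟫
  B′ = B ∩ ∁ Q
  g<q′ : ∀ {x} → x ∈ B′ → g x < q
  g<q′ x∈ = let x∈B , x∈∁Q = x∈p∩q⁻ B (∁ Q) x∈ in
    ≤∧≢⇒< (s≤s⁻¹ (g<q x∈B)) (x∈∁p⇒x∉p x∈∁Q ∘ ∈⟪⟫⁺ (λ x → g x ≟ q))
  big′ : m * q < ∣ B′ ∣
  big′ = +-cancelˡ-< m _ _ (begin-strict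
    m + m * q              ≡⟨ *-suc m q ⟨
    m * suc q              <⟨ big ⟩
    ∣ B ∣                  ≡⟨ ∣p∩q∣+∣p∩∁q∣≡∣p∣ B Q ⟨
    ∣ B ∩ Q ∣ + ∣ B′ ∣     ≤⟨ +-monoˡ-≤ _ (≮⇒≥ m≮∣H∣) ⟩
    m + ∣ B′ ∣             ∎)
    where open ≤-Reasoning

-- The joint colouring by all `g t` with `t ∈ T` is treated one `t` at a time: each application of
-- `pigeonhole-ℕ` makes one more colouring constant and costs one factor `q`.
pigeonhole-family : ∀ {k q} (m : ℕ) (T : Subset k) (g : Fin k → Fin n → Fin q) (B : Subset n) →
                    m * q ^ ∣ T ∣ < ∣ B ∣ →
                    ∃ λ H → H ⊆ B × m < ∣ H ∣ × (∀ {t} → t ∈ T → Constant (g t) H)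
pigeonhole-family m [] g B big = B , id , subst (_< ∣ B ∣) (*-identityʳ m) big , λ ()
pigeonhole-family m (outside ∷ T) g B big =
  let H , H⊆B , m<∣H∣ , const = pigeonhole-family m T (g ∘ suc) B big
  in H , H⊆B , m<∣H∣ , λ { (there t∈T) → const t∈T }
pigeonhole-family {q = q} m (inside ∷ T) g B big =
  let H₁ , H₁⊆B , big₁ , const₁ =
        pigeonhole-ℕ q (m * q ^ ∣ T ∣) (toℕ ∘ g zero) B (λ _ → toℕ<n _)
          (subst (_< ∣ B ∣) (trans (cong (m *_) (*-comm q _)) (sym (*-assoc m _ q))) big)
      H , H⊆H₁ , m<∣H∣ , const = pigeonhole-family m T (g ∘ suc) H₁ big₁
  in H , H₁⊆B ∘ H⊆H₁ , m<∣H∣ ,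
     λ { here        x∈ y∈ → toℕ-injective (const₁ (H⊆H₁ x∈) (H⊆H₁ y∈))
       ; (there t∈T) → const t∈T }

-- Independence and closure

module _ (M : Matroid n) where
  open Matroid M hiding (Simple)

  rank-⊥ : rank ⊥ ≡ 0
  rank-⊥ = n≤0⇒n≡0 (subst (rank ⊥ ≤_) (∣⊥∣≡0 n) (rank≤size ⊥))

  rank-⊆∪ : ∀ {X Y Z} → X ⊆ Y ∪ Z → rank X ≤ rank Y + rank Z
  rank-⊆∪ X⊆ = ≤-trans (rank-mono X⊆) (rank-subadditive _ _)

  ⊥-independent : Independent ⊥
  ⊥-independent = trans rank-⊥ (sym (∣⊥∣≡0 n))

  independent-⊆ : ∀ {X Y} → X ⊆ Y → Independent Y → Independent X
  independent-⊆ {X} {Y} X⊆Y indep = ≤-antisym (rank≤size X) (+-cancelʳ-≤ ∣ Y ∩ ∁ X ∣ _ _ (begin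
    ∣ X ∣ + ∣ Y ∩ ∁ X ∣         ≤⟨ +-monoˡ-≤ _ (p⊆q⇒∣p∣≤∣q∣ (λ x∈ → x∈p∩q⁺ (X⊆Y x∈ , x∈))) ⟩
    ∣ Y ∩ X ∣ + ∣ Y ∩ ∁ X ∣     ≡⟨ ∣p∩q∣+∣p∩∁q∣≡∣p∣ Y X ⟩
    ∣ Y ∣                       ≡⟨ indep ⟨
    rank Y                      ≤⟨ rank-⊆∪ (p⊆p∩∁q∪q Y X) ⟩
    rank (Y ∩ ∁ X) + rank X     ≤⟨ +-monoˡ-≤ _ (rank≤size _) ⟩
    ∣ Y ∩ ∁ X ∣ + rank X        ≡⟨ +-comm ∣ Y ∩ ∁ X ∣ _ ⟩
    rank X + ∣ Y ∩ ∁ X ∣        ∎))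
    where open ≤-Reasoning

  -- `rank (Y ∪ P) ≤ rank Y` says that `P` lies in the closure of `Y`. Submodularity is applied to
  -- `Y ∪ P` and `Y ∪ Q`, whose intersection contains `Y`.
  spans-∪ : ∀ {Y P Q} → rank (Y ∪ P) ≤ rank Y → rank (Y ∪ Q) ≤ rank Y → rank (Y ∪ (P ∪ Q)) ≤ rank Y
  spans-∪ {Y} {P} {Q} YP YQ = +-cancelʳ-≤ (rank Y) _ _ (begin
    rank (Y ∪ (P ∪ Q)) + rank Y
      ≤⟨ +-mono-≤ (rank-mono (∪⊆ (p⊆p∪q _ ∘ p⊆p∪q P)
                   (∪⊆ (p⊆p∪q _ ∘ q⊆p∪q Y P) (q⊆p∪q (Y ∪ P) _ ∘ q⊆p∪q Y Q))))
                  (rank-mono (λ x∈ → x∈p∩q⁺ (p⊆p∪q P x∈ , p⊆p∪q Q x∈))) ⟩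
    rank ((Y ∪ P) ∪ (Y ∪ Q)) + rank ((Y ∪ P) ∩ (Y ∪ Q)) ≤⟨ rank-submodular (Y ∪ P) (Y ∪ Q) ⟩
    rank (Y ∪ P) + rank (Y ∪ Q)                         ≤⟨ +-mono-≤ YP YQ ⟩
    rank Y + rank Y                                     ∎)
    where open ≤-Reasoning

  spans-pointwise : ∀ Y T → (∀ {t} → t ∈ T → rank (Y ∪ ⁅ t ⁆) ≤ rank Y) → rank (Y ∪ T) ≤ rank Y
  spans-pointwise Y = subset-rec _
    (λ _ → ≤-reflexive (cong rank (∪-identityʳ Y)))
    (λ t T ih spans → spans-∪ (spans (p⊆p∪q T (x∈⁅x⁆ t))) (ih (spans ∘ q⊆p∪q ⁅ t ⁆ T)))

  -- Greedy extension: elements of `X` that raise the rank are adjoined. When none is left, all of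
  -- `X` lies in the closure by `spans-pointwise`. The case `C = ⊥` yields a basis of `X`.
  extend-to-basis : ∀ {C X} → C ⊆ X → Independent C →
                    ∃ λ I → C ⊆ I × I ⊆ X × Independent I × rank X ≤ rank I
  extend-to-basis {C₀} {X} C₀⊆X C₀-indep = grow ∣ X ∣ C₀ (m≤n+m _ _) id C₀⊆X C₀-indep
    where
    grow : ∀ s C → ∣ X ∣ ≤ ∣ C ∣ + s → C₀ ⊆ C → C ⊆ X → Independent C →
           ∃ λ I → C₀ ⊆ I × I ⊆ X × Independent I × rank X ≤ rank I
    grow s C fuel C₀⊆C C⊆X C-indep
      with any? (λ e → (e ∈? X) ×-dec (rank C <? rank (C ∪ ⁅ e ⁆)))
    ... | no none = C , C₀⊆C , C⊆X , C-indep ,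
      ≤-trans (rank-mono (q⊆p∪q C X))
        (spans-pointwise C X (λ {t} t∈X → ≮⇒≥ (λ lt → none (t , t∈X , lt))))
    ... | yes (e , e∈X , lt) = continue s fuel
      where
      C⁺ = C ∪ ⁅ e ⁆
      ∣C∣<∣C⁺∣ : ∣ C ∣ < ∣ C⁺ ∣
      ∣C∣<∣C⁺∣ = <-≤-trans (subst (_< rank C⁺) C-indep lt) (rank≤size C⁺)
      C⁺⊆X : C⁺ ⊆ X
      C⁺⊆X = ∪⊆ C⊆X (⁅⁆⊆ e∈X)
      C⁺-indep : Independent C⁺
      C⁺-indep = ≤-antisym (rank≤size C⁺)
        (≤-trans (∣p∪⁅x⁆∣≤1+∣p∣ C e) (subst (_< rank C⁺) C-indep lt))
      continue : ∀ s → ∣ X ∣ ≤ ∣ C ∣ + s → ∃ λ I → C₀ ⊆ I × I ⊆ X × Independent I × rank X ≤ rank I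
      -- Without fuel `C` is at least as large as `X`, yet `C⁺ ⊆ X` is larger than `C`.
      continue zero    fuel = contradiction
        (≤-trans (p⊆q⇒∣p∣≤∣q∣ C⁺⊆X) (subst (∣ X ∣ ≤_) (+-identityʳ _) fuel)) (<⇒≱ ∣C∣<∣C⁺∣)
      continue (suc s) fuel = grow s C⁺
        (≤-trans (subst (∣ X ∣ ≤_) (+-suc _ s) fuel) (+-monoˡ-≤ s ∣C∣<∣C⁺∣))
        (p⊆p∪q _ ∘ C₀⊆C) C⁺⊆X C⁺-indep

  -- A dependent pair would be a circuit, because its proper subsets lie in singletons, which are
  -- independent as there are no loops. Comparing ranks with sizes is decidable, so these
  -- refutations yield independence itself.
  simple⇒pairs-independent : Simple M → ∀ {e f} → e ≢ f → Independent (⁅ e ⁆ ∪ ⁅ f ⁆)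
  simple⇒pairs-independent (loopless , parallelless) {e} {f} e≢f
    with rank (⁅ e ⁆ ∪ ⁅ f ⁆) ≟ ∣ ⁅ e ⁆ ∪ ⁅ f ⁆ ∣
  ... | yes indep = indep
  ... | no  dep   = contradiction (e≢f , dep , proper) (parallelless e f)
    where
    singleton-independent : ∀ x → Independent ⁅ x ⁆
    singleton-independent x with rank ⁅ x ⁆ ≟ ∣ ⁅ x ⁆ ∣
    ... | yes indep = indep
    ... | no  dep   = contradiction (dep , proper′) (loopless x)
      where
      proper′ : ∀ X → X ⊂ ⁅ x ⁆ → Independent X
      proper′ X (X⊆ , y , y∈ , y∉X) = independent-⊆ X⊆⊥ ⊥-independent
        where
        X⊆⊥ : X ⊆ ⊥
        X⊆⊥ z∈X = contradiction
          (subst (_∈ X) (trans (x∈⁅y⁆⇒x≡y x (X⊆ z∈X)) (sym (x∈⁅y⁆⇒x≡y x y∈))) z∈X) y∉X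
    proper : ∀ X → X ⊂ ⁅ e ⁆ ∪ ⁅ f ⁆ → Independent X
    -- The element `y` missing from `X` is `e` or `f`, so `X` lies in the other singleton.
    proper X (X⊆ , y , y∈ , y∉X) with x∈p∪q⁻ ⁅ e ⁆ ⁅ f ⁆ y∈
    ... | inj₁ y∈e = independent-⊆ X⊆f (singleton-independent f)
      where
      X⊆f : X ⊆ ⁅ f ⁆
      X⊆f z∈X = [ (λ z∈e → contradiction
        (subst (_∈ X) (trans (x∈⁅y⁆⇒x≡y e z∈e) (sym (x∈⁅y⁆⇒x≡y e y∈e))) z∈X) y∉X) , id ]′
        (x∈p∪q⁻ ⁅ e ⁆ ⁅ f ⁆ (X⊆ z∈X))
    ... | inj₂ y∈f = independent-⊆ X⊆e (singleton-independent e)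
      where
      X⊆e : X ⊆ ⁅ e ⁆
      X⊆e z∈X = [ id , (λ z∈f → contradiction
        (subst (_∈ X) (trans (x∈⁅y⁆⇒x≡y f z∈f) (sym (x∈⁅y⁆⇒x≡y f y∈f))) z∈X) y∉X) ]′
        (x∈p∪q⁻ ⁅ e ⁆ ⁅ f ⁆ (X⊆ z∈X))

-- Simplicity of the dual makes the pair independent there, and the formula for the dual rank turns
-- this into full rank of its complement.
cosimple⇒no-series-pair : (M : Matroid n) → Cosimple M → ∀ {e f} → e ≢ f →
                          Matroid.rank M ⊤ ≤ Matroid.rank M (∁ (⁅ e ⁆ ∪ ⁅ f ⁆))
cosimple⇒no-series-pair M cosimple {e} {f} e≢f = +-cancelˡ-≤ ∣ P ∣ _ _ (begin
  ∣ P ∣ + rank ⊤                                  ≡⟨ cong (_+ rank ⊤) coindep ⟨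
  ((∣ P ∣ + rank (∁ P)) ∸ rank ⊤) + rank ⊤        ≡⟨ m∸n+n≡m (<⇒≤ (m∸n≢0⇒n<m {n = rank ⊤} nonzero)) ⟩
  ∣ P ∣ + rank (∁ P)                              ∎)
  where
  open Matroid M using (rank)
  open ≤-Reasoning
  P = ⁅ e ⁆ ∪ ⁅ f ⁆
  coindep : (∣ P ∣ + rank (∁ P)) ∸ rank ⊤ ≡ ∣ P ∣
  coindep = simple⇒pairs-independent (dual M) cosimple e≢f
  -- The dual rank is a truncated difference; since it equals `∣ P ∣`, which is positive, no
  -- truncation occurs.
  nonzero : (∣ P ∣ + rank (∁ P)) ∸ rank ⊤ ≢ 0
  nonzero eq = <⇒≢ (<⇒≤ (x≢y⇒1<∣⁅x⁆∪⁅y⁆∣ e≢f)) (trans (sym eq) coindep)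

-- Minors with free elements and loops

insertAt-zipWith : ∀ {a} {A : Set a} (f : A → A → A) (xs ys : Vec A n) e x y →
                   zipWith f (insertAt xs e x) (insertAt ys e y) ≡ insertAt (zipWith f xs ys) e (f x y)
insertAt-zipWith f xs       ys       zero    x y = refl
insertAt-zipWith f (_ ∷ xs) (_ ∷ ys) (suc e) x y = cong (_ ∷_) (insertAt-zipWith f xs ys e x y)

insertAt-∩-∁ : ∀ (p q : Subset n) e s t →
               insertAt p e s ∩ ∁ (insertAt q e t) ≡ insertAt (p ∩ ∁ q) e (s ∧ not t)
insertAt-∩-∁ p q e s t = trans (cong (insertAt p e s ∩_) (map-insertAt not t q e))
                               (insertAt-zipWith _∧_ p (∁ q) e s (not t))

∣insertAt-inside∣ : ∀ (p : Subset n) e → ∣ insertAt p e inside ∣ ≡ suc ∣ p ∣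
∣insertAt-inside∣ p             zero    = refl
∣insertAt-inside∣ (outside ∷ p) (suc e) = ∣insertAt-inside∣ p e
∣insertAt-inside∣ (inside ∷ p)  (suc e) = cong suc (∣insertAt-inside∣ p e)

∣insertAt-outside∣ : ∀ (p : Subset n) e → ∣ insertAt p e outside ∣ ≡ ∣ p ∣
∣insertAt-outside∣ p             zero    = refl
∣insertAt-outside∣ (outside ∷ p) (suc e) = ∣insertAt-outside∣ p e
∣insertAt-outside∣ (inside ∷ p)  (suc e) = cong suc (∣insertAt-outside∣ p e)

-- Like `∉⇒insertAt`, meant for matching its equality with `refl`, which rewrites a set into the
-- form that the minors `M ╱ e` and `M ⧵ e` are defined with.
∈⇒insertAt : ∀ {e : Fin (suc n)} {p} → e ∈ p → ∃ λ p′ → insertAt p′ e inside ≡ p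
∈⇒insertAt {e = e} {p} e∈p =
  removeAt p e , trans (cong (insertAt (removeAt p e) e) (sym ([]=⇒lookup e∈p))) (insertAt-removeAt p e)

∉⇒insertAt : ∀ {e : Fin (suc n)} {p} → e ∉ p → ∃ λ p′ → insertAt p′ e outside ≡ p
∉⇒insertAt {e = e} {p} e∉p =
  removeAt p e , trans (cong (insertAt (removeAt p e) e) (sym lookup≡outside)) (insertAt-removeAt p e)
  where
  lookup≡outside : lookup p e ≡ outside
  lookup≡outside with lookup p e in eq
  ... | inside  = contradiction (lookup⇒[]= e p eq) e∉p
  ... | outside = refl

-- `∁ X` comes first to match the order of the summands in `U k k ⊕ U 0 ℓ`; both sides are numbered
-- in increasing order.
part : (X : Subset n) → Fin n → Fin ∣ ∁ X ∣ ⊎ Fin ∣ X ∣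
part (outside ∷ X) zero    = inj₁ zero
part (outside ∷ X) (suc i) = map₁ suc (part X i)
part (inside ∷ X)  zero    = inj₂ zero
part (inside ∷ X)  (suc i) = map₂ suc (part X i)

unpart : (X : Subset n) → Fin ∣ ∁ X ∣ ⊎ Fin ∣ X ∣ → Fin n
unpart (outside ∷ X) (inj₁ zero)    = zero
unpart (outside ∷ X) (inj₁ (suc i)) = suc (unpart X (inj₁ i))
unpart (outside ∷ X) (inj₂ j)       = suc (unpart X (inj₂ j))
unpart (inside ∷ X)  (inj₁ i)       = suc (unpart X (inj₁ i))
unpart (inside ∷ X)  (inj₂ zero)    = zero
unpart (inside ∷ X)  (inj₂ (suc j)) = suc (unpart X (inj₂ j))

part∘unpart : ∀ (X : Subset n) z → part X (unpart X z) ≡ z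
part∘unpart (outside ∷ X) (inj₁ zero)    = refl
part∘unpart (outside ∷ X) (inj₁ (suc i)) = cong (map₁ suc) (part∘unpart X (inj₁ i))
part∘unpart (outside ∷ X) (inj₂ j)       = cong (map₁ suc) (part∘unpart X (inj₂ j))
part∘unpart (inside ∷ X)  (inj₁ i)       = cong (map₂ suc) (part∘unpart X (inj₁ i))
part∘unpart (inside ∷ X)  (inj₂ zero)    = refl
part∘unpart (inside ∷ X)  (inj₂ (suc j)) = cong (map₂ suc) (part∘unpart X (inj₂ j))

unpart∘part : ∀ (X : Subset n) i → unpart X (part X i) ≡ i
unpart∘part (outside ∷ X) zero    = refl
unpart∘part (outside ∷ X) (suc i) with part X i | unpart∘part X i
... | inj₁ _ | eq = cong suc eq
... | inj₂ _ | eq = cong suc eq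
unpart∘part (inside ∷ X)  zero    = refl
unpart∘part (inside ∷ X)  (suc i) with part X i | unpart∘part X i
... | inj₁ _ | eq = cong suc eq
... | inj₂ _ | eq = cong suc eq

complement-first : (X : Subset n) → Permutation n (∣ ∁ X ∣ + ∣ X ∣)
complement-first X =
  ↔-trans (mk↔ₛ′ (part X) (unpart X) (part∘unpart X) (unpart∘part X)) (↔-sym +↔⊎)

-- `z` is an arbitrary function on the sum, so that the recursive call can absorb the shift of one
-- summand.
∣tabulate-part∩∁∣ : ∀ (X : Subset n) (z : Fin ∣ ∁ X ∣ ⊎ Fin ∣ X ∣ → Side) →
                    ∣ tabulate (z ∘ part X) ∩ ∁ X ∣ ≡ ∣ tabulate (z ∘ inj₁) ∣
∣tabulate-part∩∁∣ []            z = refl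
∣tabulate-part∩∁∣ (outside ∷ X) z with z (inj₁ zero)
... | inside  = cong suc (∣tabulate-part∩∁∣ X (z ∘ map₁ suc))
... | outside = ∣tabulate-part∩∁∣ X (z ∘ map₁ suc)
∣tabulate-part∩∁∣ (inside ∷ X)  z with z (inj₂ zero)
... | inside  = ∣tabulate-part∩∁∣ X (z ∘ map₂ suc)
... | outside = ∣tabulate-part∩∁∣ X (z ∘ map₂ suc)

tabulate-lookup-↑ˡ : ∀ {a} {A : Set a} m (xs : Vec A (m + n)) →
                     tabulate (λ i → lookup xs (i ↑ˡ n)) ≡ take m xs
tabulate-lookup-↑ˡ zero    xs       = refl
tabulate-lookup-↑ˡ (suc m) (x ∷ xs) = cong (x ∷_) (tabulate-lookup-↑ˡ m xs)

-- The hypothesis makes `∁ X` free and `X` a set of loops. On the right, the cap of the free summand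
-- is never exceeded, and the cap `0` removes the loop summand.
free⊕loops : (M : Matroid n) (X : Subset n) → (∀ Z → Matroid.rank M Z ≡ ∣ Z ∩ ∁ X ∣) →
             M ≅ U (∣ ∁ X ∣) (∣ ∁ X ∣) ⊕ U 0 (∣ X ∣)
free⊕loops M X rank≡ = complement-first X , λ Z → begin
  rank (tabulate (λ i → lookup Z (complement-first X ⟨$⟩ʳ i)))
    ≡⟨ rank≡ _ ⟩
  ∣ tabulate (λ i → lookup Z (join a b (part X i))) ∩ ∁ X ∣
    ≡⟨ ∣tabulate-part∩∁∣ X (λ z → lookup Z (join a b z)) ⟩
  ∣ tabulate (λ i → lookup Z (i ↑ˡ b)) ∣
    ≡⟨ cong ∣_∣ (tabulate-lookup-↑ˡ a Z) ⟩
  ∣ take a Z ∣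
    ≡⟨ m≤n⇒m⊓n≡m (∣p∣≤n (take a Z)) ⟨
  ∣ take a Z ∣ ⊓ a
    ≡⟨ +-identityʳ _ ⟨
  ∣ take a Z ∣ ⊓ a + 0
    ≡⟨ cong (∣ take a Z ∣ ⊓ a +_) (⊓-zeroʳ ∣ drop a Z ∣) ⟨
  ∣ take a Z ∣ ⊓ a + ∣ drop a Z ∣ ⊓ 0 ∎
  where
  open Matroid M
  open ≡-Reasoning
  a = ∣ ∁ X ∣
  b = ∣ X ∣

minor-trans : ∀ {k} {M : Matroid k} {N : Matroid m} {P : Matroid n} →
              Minor M N → Minor N P → Minor M P
minor-trans M≥N itself           = M≥N
minor-trans M≥N (delete N≥P e)   = delete (minor-trans M≥N N≥P) e
minor-trans M≥N (contract N≥P e) = contract (minor-trans M≥N N≥P) e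

minor-of-minor : ∀ {k} (L : Matroid k) {M : Matroid m} {N : Matroid n} →
                 Minor M N → HasMinorIsomorphicTo L N → HasMinorIsomorphicTo L M
minor-of-minor L M≥N (k , P , N≥P , P≅L) = k , P , minor-trans M≥N N≥P , P≅L

module _ {k ℓ : ℕ} where

  -- The minor of M obtained by contracting X ∩ I and deleting everything
  -- outside X ∪ I has I ∩ ∁ X as its free part and X ∩ ∁ I as its loops.
  free-loops-minor : ∀ {n} (M : Matroid n) X I → Matroid.Independent M I →
                     Matroid.rank M X ≤ ∣ X ∩ I ∣ → ∣ I ∩ ∁ X ∣ ≡ k → ∣ X ∩ ∁ I ∣ ≡ ℓ →
                     HasMinorIsomorphicTo (U k k ⊕ U 0 ℓ) M

  private
    -- With `X` and `I` complementary, nothing is left to contract or delete. `X ∩ I` is empty, so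
    -- `X` has rank zero, and `∁ X ⊆ I` is independent; this fixes the whole rank function.
    terminal : ∀ {n} (M : Matroid n) X I → Matroid.Independent M I →
               Matroid.rank M X ≤ ∣ X ∩ I ∣ → ∣ I ∩ ∁ X ∣ ≡ k → ∣ X ∩ ∁ I ∣ ≡ ℓ →
               (∀ {e} → e ∈ X → e ∉ I) → (∀ {e} → e ∉ X → e ∈ I) →
               HasMinorIsomorphicTo (U k k ⊕ U 0 ℓ) M
    terminal {n} M X I indep rankX≤ ∣I∖X∣≡k ∣X∖I∣≡ℓ disjoint cover =
      _ , M , itself , subst₂ (λ k ℓ → M ≅ U k k ⊕ U 0 ℓ) ∣∁X∣≡k ∣X∣≡ℓ (free⊕loops M X rank≡)
      where
      open Matroid M
      ∁X⊆I : ∁ X ⊆ I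
      ∁X⊆I = cover ∘ x∈∁p⇒x∉p
      X⊆∁I : X ⊆ ∁ I
      X⊆∁I = x∉p⇒x∈∁p ∘ disjoint
      ∣∁X∣≡k : ∣ ∁ X ∣ ≡ k
      ∣∁X∣≡k = trans (cong ∣_∣ (⊆-antisym (λ x∈ → x∈p∩q⁺ (∁X⊆I x∈ , x∈)) (p∩q⊆q I (∁ X)))) ∣I∖X∣≡k
      ∣X∣≡ℓ : ∣ X ∣ ≡ ℓ
      ∣X∣≡ℓ = trans (cong ∣_∣ (⊆-antisym (λ x∈ → x∈p∩q⁺ (x∈ , X⊆∁I x∈)) (p∩q⊆p X (∁ I)))) ∣X∖I∣≡ℓ
      rankX≡0 : rank X ≡ 0
      rankX≡0 = n≤0⇒n≡0 (≤-trans rankX≤ (subst (∣ X ∩ I ∣ ≤_) (∣⊥∣≡0 n) (p⊆q⇒∣p∣≤∣q∣ X∩I⊆⊥)))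
        where
        X∩I⊆⊥ : X ∩ I ⊆ ⊥
        X∩I⊆⊥ x∈ = let x∈X , x∈I = x∈p∩q⁻ X I x∈ in contradiction x∈I (disjoint x∈X)
      rank≡ : ∀ Z → rank Z ≡ ∣ Z ∩ ∁ X ∣
      rank≡ Z = ≤-antisym
        (≤-trans (rank-⊆∪ M (p⊆p∩∁q∪q Z X))
          (≤-trans (+-mono-≤ (rank≤size _) (≤-reflexive rankX≡0)) (≤-reflexive (+-identityʳ _))))
        (≤-trans (≤-reflexive (sym (independent-⊆ M (∁X⊆I ∘ p∩q⊆q Z (∁ X)) indep)))
          (rank-mono (p∩q⊆p Z (∁ X))))

    -- Contracting an element of `X ∩ I` or deleting one outside `X ∪ I` preserves the sizes of
    -- `I ∩ ∁ X` and `X ∩ ∁ I`. Contraction lowers both sides of the rank hypothesis by one, since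
    -- an element of `I` is no loop. The recursion is on the size of the ground set.
    step : ∀ {n} (M : Matroid (suc n)) X I → Matroid.Independent M I →
           Matroid.rank M X ≤ ∣ X ∩ I ∣ → ∣ I ∩ ∁ X ∣ ≡ k → ∣ X ∩ ∁ I ∣ ≡ ℓ →
           HasMinorIsomorphicTo (U k k ⊕ U 0 ℓ) M
    step M X I indep rankX≤ ∣I∖X∣≡k ∣X∖I∣≡ℓ
      with any? (λ e → (e ∈? X) ×-dec (e ∈? I)) | any? (λ e → ¬? (e ∈? X) ×-dec ¬? (e ∈? I))
    ... | no none | no none′ = terminal M X I indep rankX≤ ∣I∖X∣≡k ∣X∖I∣≡ℓ
      (λ {e} e∈X e∈I → none (e , e∈X , e∈I))
      (λ {e} e∉X → decidable-stable (e ∈? I) (λ e∉I → none′ (e , e∉X , e∉I)))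
    ... | yes (e , e∈X , e∈I) | _
      with X′ , refl ← ∈⇒insertAt e∈X | I′ , refl ← ∈⇒insertAt e∈I =
      minor-of-minor (U k k ⊕ U 0 ℓ) (contract itself e) (free-loops-minor (M ╱ e) X′ I′
        (cong₂ _∸_ (trans indep (∣insertAt-inside∣ I′ e)) rank-e)
        (∸-mono (≤-trans rankX≤ (≤-reflexive (trans (cong ∣_∣ (insertAt-zipWith _∧_ X′ I′ e inside inside))
                                                    (∣insertAt-inside∣ (X′ ∩ I′) e))))
                (≤-reflexive (sym rank-e)))
        (trans (sym (trans (cong ∣_∣ (insertAt-∩-∁ I′ X′ e inside inside)) (∣insertAt-outside∣ _ e))) ∣I∖X∣≡k)
        (trans (sym (trans (cong ∣_∣ (insertAt-∩-∁ X′ I′ e inside inside)) (∣insertAt-outside∣ _ e))) ∣X∖I∣≡ℓ))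
      where
      rank-e : Matroid.rank M ⁅ e ⁆ ≡ 1
      rank-e = trans (independent-⊆ M (⁅⁆⊆ e∈I) indep) (∣⁅x⁆∣≡1 e)
    ... | no _ | yes (e , e∉X , e∉I)
      with X′ , refl ← ∉⇒insertAt e∉X | I′ , refl ← ∉⇒insertAt e∉I =
      minor-of-minor (U k k ⊕ U 0 ℓ) (delete itself e) (free-loops-minor (M ⧵ e) X′ I′
        (trans indep (∣insertAt-outside∣ I′ e))
        (≤-trans rankX≤ (≤-reflexive (trans (cong ∣_∣ (insertAt-zipWith _∧_ X′ I′ e outside outside))
                                            (∣insertAt-outside∣ (X′ ∩ I′) e))))
        (trans (sym (trans (cong ∣_∣ (insertAt-∩-∁ I′ X′ e outside outside)) (∣insertAt-outside∣ _ e))) ∣I∖X∣≡k)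
        (trans (sym (trans (cong ∣_∣ (insertAt-∩-∁ X′ I′ e outside outside)) (∣insertAt-outside∣ _ e))) ∣X∖I∣≡ℓ))

  free-loops-minor {zero}  M X I indep rankX≤ k≡ ℓ≡ =
    terminal M X I indep rankX≤ k≡ ℓ≡ (λ { {()} }) (λ { {()} })
  free-loops-minor {suc n} = step

  -- A basis `C` of `X` is extended to a basis `B` of `M`. Then `B ∩ ∁ X` has at least `k` elements
  -- and `X ∩ ∁ B` at least `ℓ`; exactly `k` and `ℓ` of them are kept.
  corank-nullity⇒minor : ∀ {n} (M : Matroid n) X →
                         Matroid.rank M X + k ≤ Matroid.rank M ⊤ → Matroid.rank M X + ℓ ≤ ∣ X ∣ →
                         HasMinorIsomorphicTo (U k k ⊕ U 0 ℓ) M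
  corank-nullity⇒minor M X corank nullity =
    let C , _ , C⊆X , C-indep , rankX≤  = extend-to-basis M ⊥⊆ (⊥-independent M)
        B , C⊆B , _ , B-indep , rank⊤≤ = extend-to-basis M ⊆⊤ C-indep
    in from-bases C⊆X rankX≤ C⊆B B-indep rank⊤≤
    where
    open Matroid M
    open ≤-Reasoning

    from-bases : ∀ {C B} → C ⊆ X → rank X ≤ rank C → C ⊆ B → Independent B → rank ⊤ ≤ rank B →
                 HasMinorIsomorphicTo (U k k ⊕ U 0 ℓ) M
    from-bases {C} {B} C⊆X rankX≤ C⊆B B-indep rank⊤≤ =
      let K , K⊆ , ∣K∣≡k = subset-of-size k (B ∩ ∁ X) k≤
          L , L⊆ , ∣L∣≡ℓ = subset-of-size ℓ (X ∩ ∁ B) ℓ≤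
      in trim K⊆ ∣K∣≡k L⊆ ∣L∣≡ℓ
      where
      k≤ : k ≤ ∣ B ∩ ∁ X ∣
      -- Here and in `ℓ≤`, the part of `B` inside `X` is independent, hence has at most `rank X`
      -- elements.
      k≤ = +-cancelˡ-≤ (rank X) _ _ (begin
        rank X + k                    ≤⟨ corank ⟩
        rank ⊤                        ≤⟨ rank⊤≤ ⟩
        rank B                        ≤⟨ rank≤size B ⟩
        ∣ B ∣                         ≡⟨ ∣p∩q∣+∣p∩∁q∣≡∣p∣ B X ⟨
        ∣ B ∩ X ∣ + ∣ B ∩ ∁ X ∣       ≡⟨ cong (_+ ∣ B ∩ ∁ X ∣) (independent-⊆ M (p∩q⊆p B X) B-indep) ⟨
        rank (B ∩ X) + ∣ B ∩ ∁ X ∣    ≤⟨ +-monoˡ-≤ _ (rank-mono (p∩q⊆q B X)) ⟩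
        rank X + ∣ B ∩ ∁ X ∣          ∎)
      ℓ≤ : ℓ ≤ ∣ X ∩ ∁ B ∣
      ℓ≤ = +-cancelˡ-≤ (rank X) _ _ (begin
        rank X + ℓ                    ≤⟨ nullity ⟩
        ∣ X ∣                         ≡⟨ ∣p∩q∣+∣p∩∁q∣≡∣p∣ X B ⟨
        ∣ X ∩ B ∣ + ∣ X ∩ ∁ B ∣       ≡⟨ cong (_+ ∣ X ∩ ∁ B ∣) (independent-⊆ M (p∩q⊆q X B) B-indep) ⟨
        rank (X ∩ B) + ∣ X ∩ ∁ B ∣    ≤⟨ +-monoˡ-≤ _ (rank-mono (p∩q⊆p X B)) ⟩
        rank X + ∣ X ∩ ∁ B ∣          ∎)
      trim : ∀ {K L} → K ⊆ B ∩ ∁ X → ∣ K ∣ ≡ k → L ⊆ X ∩ ∁ B → ∣ L ∣ ≡ ℓ →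
             HasMinorIsomorphicTo (U k k ⊕ U 0 ℓ) M
      -- `(C ∪ L) ∩ (C ∪ K)` is `C`; contracting it turns `L` into loops and leaves `K` free.
      trim {K} {L} K⊆ ∣K∣≡k L⊆ ∣L∣≡ℓ = free-loops-minor M (C ∪ L) (C ∪ K)
        (independent-⊆ M (∪⊆ C⊆B K⊆B) B-indep)
        (≤-trans (rank-mono (∪⊆ C⊆X L⊆X)) (≤-trans rankX≤ (≤-trans (rank≤size C)
          (p⊆q⇒∣p∣≤∣q∣ {p = C} (λ x∈ → x∈p∩q⁺ (p⊆p∪q L x∈ , p⊆p∪q K x∈))))))
        (trans (cong ∣_∣ (∪-∩-∁-∪ C⊆X L⊆X K⊆∁X)) ∣K∣≡k)
        (trans (cong ∣_∣ (∪-∩-∁-∪ C⊆B K⊆B L⊆∁B)) ∣L∣≡ℓ)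
        where
        K⊆B  : K ⊆ B
        K⊆B  = p∩q⊆p B (∁ X) ∘ K⊆
        K⊆∁X : K ⊆ ∁ X
        K⊆∁X = p∩q⊆q B (∁ X) ∘ K⊆
        L⊆X  : L ⊆ X
        L⊆X  = p∩q⊆p X (∁ B) ∘ L⊆
        L⊆∁B : L ⊆ ∁ B
        L⊆∁B = p∩q⊆q X (∁ B) ∘ L⊆

-- Enumeration of matroids of bounded size

allSubsets? : ∀ {a} {P : Subset n → Set a} → (∀ X → Dec (P X)) → Dec (∀ X → P X)
allSubsets? P? = map′ (λ none X → decidable-stable (P? X) (λ ¬PX → none (X , ¬PX)))
                      (λ all (X , ¬PX) → ¬PX (all X))
                      (¬? (anySubset? (¬? ∘ P?)))

combine : (Subset n → ℕ) → (Subset n → ℕ) → Subset (suc n) → ℕ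
combine f g (inside ∷ X)  = f X
combine f g (outside ∷ X) = g X

functions : ∀ n → ℕ → List (Subset n → ℕ)
functions zero    b = List.map const (upTo (suc b))
functions (suc n) b = cartesianProductWith combine (functions n b) (functions n b)

-- Membership is up to pointwise equality, which is all that `_≅_` sees of a rank function.
∈-functions : ∀ n b (f : Subset n → ℕ) → (∀ X → f X ≤ b) → Any (f ≗_) (functions n b)
∈-functions zero    b f f≤b = Any.map⁺ (lose (∈-upTo⁺ (s≤s (f≤b []))) λ { [] → refl })
∈-functions (suc n) b f f≤b = Any.cartesianProductWith⁺ combine
  (λ f≗ g≗ → λ { (inside ∷ X) → f≗ X ; (outside ∷ X) → g≗ X })
  (∈-functions n b (f ∘ (inside ∷_)) (f≤b ∘ (inside ∷_)))
  (∈-functions n b (f ∘ (outside ∷_)) (f≤b ∘ (outside ∷_)))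

IsRank : (Subset n → ℕ) → Set
IsRank r = (∀ X → r X ≤ ∣ X ∣)
         × (∀ X Y → X ⊆ Y → r X ≤ r Y)
         × (∀ X Y → r (X ∪ Y) + r (X ∩ Y) ≤ r X + r Y)

isRank? : (r : Subset n → ℕ) → Dec (IsRank r)
isRank? r = allSubsets? (λ X → r X ≤? ∣ X ∣)
      ×-dec allSubsets? (λ X → allSubsets? λ Y → (X ⊆? Y) →-dec (r X ≤? r Y))
      ×-dec allSubsets? (λ X → allSubsets? λ Y → r (X ∪ Y) + r (X ∩ Y) ≤? r X + r Y)

fromRank : (r : Subset n → ℕ) → IsRank r → Matroid n
fromRank r (r≤size , r-mono , r-submodular) = record
  { rank            = r
  ; rank≤size       = r≤size
  ; rank-mono       = r-mono _ _
  ; rank-submodular = r-submodular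
  }

rank-isRank : (M : Matroid n) {r : Subset n → ℕ} → Matroid.rank M ≗ r → IsRank r
rank-isRank M eq =
  (λ X → subst (_≤ ∣ X ∣) (eq X) (rank≤size X)) ,
  (λ X Y X⊆Y → subst₂ _≤_ (eq X) (eq Y) (rank-mono X⊆Y)) ,
  (λ X Y → subst₂ _≤_ (cong₂ _+_ (eq _) (eq _)) (cong₂ _+_ (eq X) (eq Y)) (rank-submodular X Y))
  where open Matroid M

-- A list with at most one entry, so that `concatMap` discards the functions violating the axioms.
matroids-with-rank : (Subset n → ℕ) → List (∃ Matroid)
matroids-with-rank r with isRank? r
... | yes isRank = (_ , fromRank r isRank) ∷ []
... | no  _      = []

∈-matroids-with-rank : (M : Matroid n) {r : Subset n → ℕ} → Matroid.rank M ≗ r →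
                       Any (λ N → M ≅ proj₂ N) (matroids-with-rank r)
∈-matroids-with-rank M {r} eq with isRank? r
... | yes isRank = here (Permutation.id , λ X →
                     trans (cong (Matroid.rank M) (tabulate∘lookup X)) (eq X))
... | no  ¬rank  = contradiction (rank-isRank M eq) ¬rank

matroids-of-size : ℕ → List (∃ Matroid)
matroids-of-size n = concatMap matroids-with-rank (functions n n)

∈-matroids-of-size : (M : Matroid n) → Any (λ N → M ≅ proj₂ N) (matroids-of-size n)
∈-matroids-of-size {n} M = Any.concatMap⁺ matroids-with-rank
  (Any.map (∈-matroids-with-rank M)
    (∈-functions n n (Matroid.rank M) (λ X → ≤-trans (Matroid.rank≤size M X) (∣p∣≤n X))))

finitely-many-of-bounded-size : ∀ N → FinitelyManyUpToIsomorphism (λ {n} _ → n ≤ N)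
finitely-many-of-bounded-size N =
  concatMap matroids-of-size (upTo (suc N)) ,
  λ M n≤N → Any.concatMap⁺ matroids-of-size (lose (∈-upTo⁺ (s≤s n≤N)) (∈-matroids-of-size M))

-- Matroids represented over a finite field

module FiniteField {c ℓ₁ ℓ₂} (F : HeytingField c ℓ₁ ℓ₂) {q} (order : HasOrder F q) where

  open HeytingField F using (#⇒invertible; tight; heytingCommutativeRing)
  open HeytingCommutativeRingProperties heytingCommutativeRing using (x-0≈x)

  R : CommutativeRing c ℓ₁
  R = HeytingCommutativeRing.commutativeRing heytingCommutativeRing

  open CommutativeRing R
    using ( Carrier; _≈_; 0#; 1#; setoid; ring; semiring; reflexive; +-cong; +-congˡ; *-cong; *-congˡ; *-congʳ
          ; zeroʳ; distribʳ; -‿cong; -‿inverseʳ )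
    renaming ( _+_ to _+ᶠ_; _*_ to _*ᶠ_; -_ to -ᶠ_; refl to ≈-refl; sym to ≈-sym; trans to ≈-trans
             ; +-identityʳ to +ᶠ-identityʳ; *-identityʳ to *ᶠ-identityʳ; *-assoc to *ᶠ-assoc )
  open SemiringSum semiring using (sum; sum-cong-≋; ∑-distrib-+; *-distribˡ-sum)
  open RingProperties ring using (-1*x≈-x; -‿distribˡ-*)
  open Bijection order using (to; injective; surjective) renaming (cong to to-cong)
  module ≈-Reasoning = SetoidReasoning setoid

  from : Fin q → Carrier
  from i = proj₁ (surjective i)

  from∘to : ∀ x → from (to x) ≈ x
  from∘to x = injective (proj₂ (surjective (to x)) ≈-refl)

  _≈?_ : ∀ x y → Dec (x ≈ y)
  x ≈? y = map′ injective to-cong (to x ≟ᶠ to y)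

  q-nonZero : NonZero q
  q-nonZero = nonZeroIndex (to 0#)

  -- An element apart from zero is invertible, so a search through all `q` elements that finds no
  -- inverse refutes apartness, and tightness gives `x ≈ 0#`.
  inverse : ∀ {x} → ¬ x ≈ 0# → ∃ λ y → y *ᶠ x ≈ 1#
  inverse {x} x≉0 with any? (λ i → (from i *ᶠ x) ≈? 1#)
  ... | yes (i , eq) = from i , eq
  ... | no  none     = contradiction (proj₁ (tight x 0#) ¬x#0) x≉0
    where
    ¬x#0 : ¬ HeytingField._#_ F x 0#
    ¬x#0 x#0 = let y , y*x≈1 , _ = #⇒invertible x#0 in
      none (to y , ≈-trans (*-cong (from∘to y) (≈-sym (x-0≈x x))) y*x≈1)

  cancel : ∀ x {y} → ¬ y ≈ 0# → ∃ λ c → x +ᶠ c *ᶠ y ≈ 0#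
  cancel x {y} y≉0 = let y⁻¹ , y⁻¹*y≈1 = inverse y≉0 in
    -ᶠ (x *ᶠ y⁻¹) , (begin
      x +ᶠ (-ᶠ (x *ᶠ y⁻¹)) *ᶠ y ≈⟨ +-congˡ (-‿distribˡ-* _ y) ⟨
      x +ᶠ -ᶠ (x *ᶠ y⁻¹ *ᶠ y)   ≈⟨ +-congˡ (-‿cong (*ᶠ-assoc x y⁻¹ y)) ⟩
      x +ᶠ -ᶠ (x *ᶠ (y⁻¹ *ᶠ y)) ≈⟨ +-congˡ (-‿cong (*-congˡ y⁻¹*y≈1)) ⟩
      x +ᶠ -ᶠ (x *ᶠ 1#)         ≈⟨ +-congˡ (-‿cong (*ᶠ-identityʳ x)) ⟩
      x +ᶠ -ᶠ x                 ≈⟨ -‿inverseʳ x ⟩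
      0#                        ∎)
    where open ≈-Reasoning

  x+c*0≈x : ∀ {x y} c → y ≈ 0# → x +ᶠ c *ᶠ y ≈ x
  x+c*0≈x {x} {y} c y≈0 = begin
    x +ᶠ c *ᶠ y  ≈⟨ +-congˡ (*-congˡ y≈0) ⟩
    x +ᶠ c *ᶠ 0# ≈⟨ +-congˡ (zeroʳ c) ⟩
    x +ᶠ 0#      ≈⟨ +ᶠ-identityʳ x ⟩
    x            ∎
    where open ≈-Reasoning

  0+c*0≈0 : ∀ {x y} c → x ≈ 0# → y ≈ 0# → x +ᶠ c *ᶠ y ≈ 0#
  0+c*0≈0 c x≈0 y≈0 = ≈-trans (x+c*0≈x c y≈0) x≈0

  x+[-1]*y≈0 : ∀ {x y} → x ≈ y → x +ᶠ (-ᶠ 1#) *ᶠ y ≈ 0#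
  x+[-1]*y≈0 {x} {y} x≈y = begin
    x +ᶠ (-ᶠ 1#) *ᶠ y ≈⟨ +-cong x≈y (-1*x≈-x y) ⟩
    y +ᶠ -ᶠ y         ≈⟨ -‿inverseʳ y ⟩
    0#                ∎
    where open ≈-Reasoning

  -- Linear relations among the columns of a representing matrix

  Supported : (Fin n → Carrier) → Subset n → Set ℓ₁
  Supported a X = ∀ {j} → j ∉ X → a j ≈ 0#

  module Represented {n d} (M : Matroid n) (A : Fin d → Fin n → Carrier)
    (independent⇔ : ∀ X → Matroid.Independent M X ⇔ LinearlyIndependentColumns F A X) where

    open Matroid M using (rank; rank≤size; rank-mono; Independent)

    -- The kernel of `A`, seen as the linear code with parity-check matrix `A`.
    Codeword : (Fin n → Carrier) → Set ℓ₁
    Codeword a = ∀ i → sum (λ j → a j *ᶠ A i j) ≈ 0#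

    codeword-+ : ∀ {a b} c → Codeword a → Codeword b → Codeword (λ j → a j +ᶠ c *ᶠ b j)
    codeword-+ {a} {b} c a-code b-code i = begin
      sum (λ j → (a j +ᶠ c *ᶠ b j) *ᶠ A i j)
        ≈⟨ sum-cong-≋ (λ j → ≈-trans (distribʳ (A i j) (a j) (c *ᶠ b j)) (+-congˡ (*ᶠ-assoc c (b j) (A i j)))) ⟩
      sum (λ j → a j *ᶠ A i j +ᶠ c *ᶠ (b j *ᶠ A i j))
        ≈⟨ ∑-distrib-+ (λ j → a j *ᶠ A i j) (λ j → c *ᶠ (b j *ᶠ A i j)) ⟩
      sum (λ j → a j *ᶠ A i j) +ᶠ sum (λ j → c *ᶠ (b j *ᶠ A i j))
        ≈⟨ +-congˡ (*-distribˡ-sum c (λ j → b j *ᶠ A i j)) ⟨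
      sum (λ j → a j *ᶠ A i j) +ᶠ c *ᶠ sum (λ j → b j *ᶠ A i j)
        ≈⟨ 0+c*0≈0 c (a-code i) (b-code i) ⟩
      0# ∎
      where open ≈-Reasoning

    independent⇒zero : ∀ {X a} → Independent X → Codeword a → Supported a X → ∀ j → a j ≈ 0#
    independent⇒zero {X} {a} indep a-code supp =
      Equivalence.to (independent⇔ X) indep a (λ _ → supp) a-code

    -- Dependence is a negated statement, so a relation has to be found: all `q ^ n` vectors are
    -- searched, and if none fits, the columns of `X` are linearly independent.
    dependent⇒codeword : ∀ {X} → ¬ Independent X →
                         ∃ λ a → Codeword a × Supported a X × ∃ λ j → ¬ a j ≈ 0#
    dependent⇒codeword {X} dep = conclude (any? {n = q ^ n} λ k →
      all? (λ i → sum (λ j → vector k j *ᶠ A i j) ≈? 0#) ×-dec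
      all? (λ j → ¬? (j ∈? X) →-dec (vector k j ≈? 0#)) ×-dec
      any? (λ j → ¬? (vector k j ≈? 0#)))
      where
      vector : Fin (q ^ n) → Fin n → Carrier
      vector k = from ∘ finToFun k

      index : (Fin n → Carrier) → Fin (q ^ n)
      index a = funToFin (to ∘ a)

      vector∘index : ∀ a j → vector (index a) j ≈ a j
      vector∘index a j = ≈-trans (reflexive (cong from (finToFun-funToFin (to ∘ a) j))) (from∘to (a j))

      conclude : Dec (∃ λ k → Codeword (vector k) × (∀ j → j ∉ X → vector k j ≈ 0#) × ∃ λ j → ¬ vector k j ≈ 0#) →
                 ∃ λ a → Codeword a × Supported a X × ∃ λ j → ¬ a j ≈ 0#
      conclude (yes (k , code , supp , nonzero)) = vector k , code , supp _ , nonzero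
      conclude (no  none) = contradiction (Equivalence.from (independent⇔ X) columns-independent) dep
        where
        columns-independent : LinearlyIndependentColumns F A X
        columns-independent a supp code j = decidable-stable (a j ≈? 0#) λ aj≉0 → none
          ( index a
          , (λ i → ≈-trans (sum-cong-≋ (λ j → *-congʳ (vector∘index a j))) (code i))
          , (λ j j∉X → ≈-trans (vector∘index a j) (supp j j∉X))
          , j , λ eq → aj≉0 (≈-trans (≈-sym (vector∘index a j)) eq))

    -- If Y is dependent, then some y ∈ Y in the support of a codeword on Y is
    -- spanned by Y ∖ {y}, and w can be cleared at y by a multiple of it.
    codeword⇒spans : ∀ {Y e w} → Codeword w → Supported w (Y ∪ ⁅ e ⁆) → ¬ w e ≈ 0# →
                     rank (Y ∪ ⁅ e ⁆) ≤ rank Y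
    codeword⇒spans {Y₀} = by-size ∣ Y₀ ∣ ≤-refl
      where
      by-size : ∀ s {Y e w} → ∣ Y ∣ ≤ s → Codeword w → Supported w (Y ∪ ⁅ e ⁆) → ¬ w e ≈ 0# →
                rank (Y ∪ ⁅ e ⁆) ≤ rank Y
      by-size s {Y} {e} {w} ∣Y∣≤s w-code w-supp we≉0 with e ∈? Y | rank Y ≟ ∣ Y ∣
      ... | yes e∈Y | _ = rank-mono (∪⊆ id (⁅⁆⊆ e∈Y))
      -- If `Y ∪ ⁅ e ⁆` were independent, `w` would vanish at `e`; so its rank is below `suc ∣ Y ∣`.
      ... | no e∉Y | yes Y-indep = s≤s⁻¹ (begin-strict
        rank (Y ∪ ⁅ e ⁆)  <⟨ ≤∧≢⇒< (rank≤size _) (λ indep → we≉0 (independent⇒zero indep w-code w-supp e)) ⟩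
        ∣ Y ∪ ⁅ e ⁆ ∣     ≤⟨ ∣p∪⁅x⁆∣≤1+∣p∣ Y e ⟩
        suc ∣ Y ∣         ≡⟨ cong suc Y-indep ⟨
        suc (rank Y)      ∎)
        where open ≤-Reasoning
      ... | no e∉Y | no Y-dep = eliminate s ∣Y∣≤s (dependent⇒codeword Y-dep)
        where
        eliminate : ∀ s → ∣ Y ∣ ≤ s → (∃ λ u → Codeword u × Supported u Y × ∃ λ y → ¬ u y ≈ 0#) →
                    rank (Y ∪ ⁅ e ⁆) ≤ rank Y
        eliminate s ∣Y∣≤s (u , u-code , u-supp , y , uy≉0) = smaller s ∣Y∣≤s
          where
          Y′ : Subset n
          Y′ = Y ∩ ∁ ⁅ y ⁆

          y∈Y : y ∈ Y
          y∈Y = decidable-stable (y ∈? Y) (uy≉0 ∘ u-supp)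

          ∣Y′∣<∣Y∣ : ∣ Y′ ∣ < ∣ Y ∣
          ∣Y′∣<∣Y∣ = p⊂q⇒∣p∣<∣q∣
            (p∩q⊆p Y _ , y , y∈Y , λ y∈Y′ → x∈∁p⇒x∉p (p∩q⊆q Y _ y∈Y′) (x∈⁅x⁆ y))

          κ : Carrier
          κ = proj₁ (cancel (w y) uy≉0)

          w′ : Fin n → Carrier
          w′ j = w j +ᶠ κ *ᶠ u j

          w′-supp : Supported w′ (Y′ ∪ ⁅ e ⁆)
          w′-supp {j} j∉ with j ≟ᶠ y
          ... | yes refl = proj₂ (cancel (w y) uy≉0)
          ... | no  j≢y  = 0+c*0≈0 κ (w-supp (∉∪ j∉Y (j∉ ∘ q⊆p∪q Y′ ⁅ e ⁆))) (u-supp j∉Y)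
            where
            j∉Y : j ∉ Y
            j∉Y j∈Y = j∉ (p⊆p∪q ⁅ e ⁆ (x∈p∩q⁺ (j∈Y , x∉p⇒x∈∁p (x≢y⇒x∉⁅y⁆ j≢y))))

          w′e≉0 : ¬ w′ e ≈ 0#
          w′e≉0 eq = we≉0 (≈-trans (≈-sym (x+c*0≈x κ (u-supp e∉Y))) eq)

          smaller : ∀ s → ∣ Y ∣ ≤ s → rank (Y ∪ ⁅ e ⁆) ≤ rank Y
          smaller zero    ∣Y∣≤0 = contradiction (≤-trans ∣Y′∣<∣Y∣ ∣Y∣≤0) λ ()
          -- By induction, `u` puts `y` and `w′` puts `e` in the closure of `Y′`, and these two
          -- together with `Y′` cover `Y ∪ ⁅ e ⁆`.
          smaller (suc s) ∣Y∣≤s = begin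
            rank (Y ∪ ⁅ e ⁆)              ≤⟨ rank-mono Y∪e⊆ ⟩
            rank (Y′ ∪ (⁅ y ⁆ ∪ ⁅ e ⁆))   ≤⟨ spans-∪ M
                                               (by-size s ∣Y′∣≤s u-code (u-supp ∘ (_∘ p⊆p∩∁q∪q Y ⁅ y ⁆)) uy≉0)
                                               (by-size s ∣Y′∣≤s (codeword-+ κ w-code u-code) w′-supp w′e≉0) ⟩
            rank Y′                       ≤⟨ rank-mono (p∩q⊆p Y _) ⟩
            rank Y                        ∎
            where
            open ≤-Reasoning
            ∣Y′∣≤s : ∣ Y′ ∣ ≤ s
            ∣Y′∣≤s = s≤s⁻¹ (≤-trans ∣Y′∣<∣Y∣ ∣Y∣≤s)
            Y∪e⊆ : Y ∪ ⁅ e ⁆ ⊆ Y′ ∪ (⁅ y ⁆ ∪ ⁅ e ⁆)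
            Y∪e⊆ = ∪⊆ (∪⊆ (p⊆p∪q _) (q⊆p∪q Y′ _ ∘ p⊆p∪q ⁅ e ⁆) ∘ p⊆p∩∁q∪q Y ⁅ y ⁆)
                      (q⊆p∪q Y′ _ ∘ q⊆p∪q ⁅ y ⁆ ⁅ e ⁆)

    -- Fundamental circuits relative to a basis, and size bounds

    record Fundamental (B : Subset n) (f : Fin n) (v : Fin n → Carrier) : Set ℓ₁ where
      field
        codeword  : Codeword v
        supported : Supported v (B ∪ ⁅ f ⁆)
        nonzero   : ¬ v f ≈ 0#

      vanishes : ∀ {j} → j ∉ B → j ≢ f → v j ≈ 0#
      vanishes j∉B j≢f = supported (∉∪ j∉B (x≢y⇒x∉⁅y⁆ j≢f))

    module WithBasis {B : Subset n} (B-indep : Independent B) (rank⊤≤rankB : rank ⊤ ≤ rank B) where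

      -- A relation exists because `B ∪ ⁅ f ⁆` has more elements than the rank of `M`, and it cannot
      -- vanish at `f` because `B` is independent. The condition `f ∉ B` comes after the vector, so
      -- that `v` is defined at every index and can serve as a colouring.
      fundamental : ∀ f → ∃ λ v → f ∉ B → Fundamental B f v
      fundamental f with f ∈? B
      -- The zero vector is a default value; nothing is claimed about it.
      ... | yes f∈B = (λ _ → 0#) , contradiction f∈B
      ... | no  f∉B = v , λ _ → record { codeword = v-code ; supported = v-supp ; nonzero = vf≉0 }
        where
        B∪f-dependent : ¬ Independent (B ∪ ⁅ f ⁆)
        B∪f-dependent indep = <⇒≱ (x∉p⇒∣p∣<∣p∪⁅x⁆∣ B f∉B) (begin
          ∣ B ∪ ⁅ f ⁆ ∣     ≡⟨ indep ⟨
          rank (B ∪ ⁅ f ⁆)  ≤⟨ rank-mono ⊆⊤ ⟩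
          rank ⊤            ≤⟨ rank⊤≤rankB ⟩
          rank B            ≡⟨ B-indep ⟩
          ∣ B ∣             ∎)
          where open ≤-Reasoning
        dependency = dependent⇒codeword B∪f-dependent
        v : Fin n → Carrier
        v = proj₁ dependency
        v-code : Codeword v
        v-code = proj₁ (proj₂ dependency)
        v-supp : Supported v (B ∪ ⁅ f ⁆)
        v-supp = proj₁ (proj₂ (proj₂ dependency))
        vf≉0 : ¬ v f ≈ 0#
        vf≉0 vf≈0 =
          let j , vj≉0 = proj₂ (proj₂ (proj₂ dependency))
          in vj≉0 (independent⇒zero B-indep v-code v-suppB j)
          where
          v-suppB : Supported v B
          v-suppB {j} j∉B with j ≟ᶠ f
          ... | yes refl = vf≈0
          ... | no  j≢f  = v-supp (∉∪ j∉B (x≢y⇒x∉⁅y⁆ j≢f))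

      v : Fin n → Fin n → Carrier
      v f = proj₁ (fundamental f)

      module V {f} (f∉B : f ∉ B) = Fundamental (proj₂ (fundamental f) f∉B)

      color : Fin n → Fin n → Fin q
      color f j = to (v f j)

      -- In coordinates relative to B, each column t ∈ T is constant on H, so
      -- after contracting B ∖ H the columns in T are multiples of one vector.
      rank-constant≤ : ∀ {H T h} → h ∈ H → T ⊆ ∁ B → (∀ {t} → t ∈ T → Constant (color t) H) →
                       rank ((B ∩ ∁ H) ∪ T) ≤ suc ∣ B ∩ ∁ H ∣
      rank-constant≤ {H} {T} {h} h∈H T⊆∁B constant
        with any? (λ t → (t ∈? T) ×-dec ¬? (v t h ≈? 0#))
      -- All `v t` vanish at `h`, hence on `H`, so `B ∩ ∁ H` already spans `T`.
      ... | no none = begin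
        rank ((B ∩ ∁ H) ∪ T) ≤⟨ spans-pointwise M (B ∩ ∁ H) T (λ t∈T →
                                  codeword⇒spans (V.codeword (∉B t∈T)) (support t∈T) (V.nonzero (∉B t∈T))) ⟩
        rank (B ∩ ∁ H)       ≤⟨ rank≤size (B ∩ ∁ H) ⟩
        ∣ B ∩ ∁ H ∣          ≤⟨ n≤1+n _ ⟩
        suc ∣ B ∩ ∁ H ∣      ∎
        where
        open ≤-Reasoning
        ∉B : ∀ {t} → t ∈ T → t ∉ B
        ∉B t∈T = x∈∁p⇒x∉p (T⊆∁B t∈T)
        vth≈0 : ∀ {t} → t ∈ T → v t h ≈ 0#
        vth≈0 {t} t∈T = decidable-stable (v t h ≈? 0#) (λ ≉0 → none (t , t∈T , ≉0))
        support : ∀ {t} → t ∈ T → Supported (v t) ((B ∩ ∁ H) ∪ ⁅ t ⁆)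
        support {t} t∈T {j} j∉ with j ∈? H
        ... | yes j∈H = ≈-trans (injective (constant t∈T j∈H h∈H)) (vth≈0 t∈T)
        ... | no  j∉H = V.supported (∉B t∈T)
          (∉∪ (λ j∈B → j∉ (p⊆p∪q ⁅ t ⁆ (x∈p∩q⁺ (j∈B , x∉p⇒x∈∁p j∉H)))) (j∉ ∘ q⊆p∪q (B ∩ ∁ H) ⁅ t ⁆))
      -- `t₀` serves as a pivot: adding a multiple of `v t₀` clears `v t` at `h`, hence by constancy
      -- on all of `H`, so `t` is spanned by `B ∩ ∁ H` and `t₀`.
      ... | yes (t₀ , t₀∈T , vt₀h≉0) = begin
        rank ((B ∩ ∁ H) ∪ T) ≤⟨ rank-mono (∪-monoˡ-⊆ T (p⊆p∪q ⁅ t₀ ⁆)) ⟩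
        rank (Y ∪ T)         ≤⟨ spans-pointwise M Y T spans ⟩
        rank Y               ≤⟨ rank≤size Y ⟩
        ∣ Y ∣                ≤⟨ ∣p∪⁅x⁆∣≤1+∣p∣ (B ∩ ∁ H) t₀ ⟩
        suc ∣ B ∩ ∁ H ∣      ∎
        where
        open ≤-Reasoning
        ∉B : ∀ {t} → t ∈ T → t ∉ B
        ∉B t∈T = x∈∁p⇒x∉p (T⊆∁B t∈T)
        Y : Subset n
        Y = (B ∩ ∁ H) ∪ ⁅ t₀ ⁆
        spans : ∀ {t} → t ∈ T → rank (Y ∪ ⁅ t ⁆) ≤ rank Y
        spans {t} t∈T with t ≟ᶠ t₀
        ... | yes refl = rank-mono (∪⊆ id (q⊆p∪q (B ∩ ∁ H) ⁅ t ⁆))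
        ... | no  t≢t₀ = codeword⇒spans
          (codeword-+ κ (V.codeword (∉B t∈T)) (V.codeword (∉B t₀∈T))) support
          -- `v t₀` vanishes at `t`, so the combination keeps the nonzero value `v t t`.
          (V.nonzero (∉B t∈T) ∘ ≈-trans (≈-sym (x+c*0≈x κ (V.vanishes (∉B t₀∈T) (∉B t∈T) t≢t₀))))
          where
          κ : Carrier
          κ = proj₁ (cancel (v t h) vt₀h≉0)
          support : Supported (λ j → v t j +ᶠ κ *ᶠ v t₀ j) (Y ∪ ⁅ t ⁆)
          support {j} j∉ with j ∈? H
          ... | yes j∈H = ≈-trans
            (+-cong (injective (constant t∈T j∈H h∈H)) (*-congˡ (injective (constant t₀∈T j∈H h∈H))))
            (proj₂ (cancel (v t h) vt₀h≉0))
          ... | no  j∉H = 0+c*0≈0 κ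
            (V.supported (∉B t∈T) (∉∪ j∉B (j∉ ∘ q⊆p∪q Y ⁅ t ⁆)))
            (V.supported (∉B t₀∈T) (∉∪ j∉B (j∉ ∘ p⊆p∪q ⁅ t ⁆ ∘ q⊆p∪q (B ∩ ∁ H) ⁅ t₀ ⁆)))
            where
            j∉B : j ∉ B
            j∉B j∈B = j∉ (p⊆p∪q ⁅ t ⁆ (p⊆p∪q ⁅ t₀ ⁆ (x∈p∩q⁺ (j∈B , x∉p⇒x∈∁p j∉H))))

      -- If `v f` and `v f′` agree on `B`, their difference is a relation supported on
      -- `⁅ f ⁆ ∪ ⁅ f′ ⁆`, which is independent in a simple matroid; yet at `f` it keeps the nonzero
      -- value `v f f`.
      simple⇒∣∁B∣≤ : Simple M → ∣ ∁ B ∣ ≤ q ^ ∣ B ∣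
      simple⇒∣∁B∣≤ simple = ≮⇒≥ λ big →
        let H , H⊆∁B , 1<∣H∣ , constant =
              -- The elements of `∁ B` are coloured here, and those of `B` index the colourings; the
              -- other two bounds exchange these roles.
              pigeonhole-family 1 B (λ b f → color f b) (∁ B) (subst (_< ∣ ∁ B ∣) (sym (*-identityˡ _)) big)
            f , f′ , f≢f′ , f∈H , f′∈H = 1<∣p∣⇒two-elements H 1<∣H∣
        in no-equal-columns (x∈∁p⇒x∉p (H⊆∁B f∈H)) (x∈∁p⇒x∉p (H⊆∁B f′∈H)) f≢f′
             (λ b∈B → injective (constant b∈B f∈H f′∈H))
        where
        no-equal-columns : ∀ {f f′} → f ∉ B → f′ ∉ B → f ≢ f′ → ¬ (∀ {b} → b ∈ B → v f b ≈ v f′ b)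
        no-equal-columns {f} {f′} f∉B f′∉B f≢f′ equal = V.nonzero f∉B
          (≈-trans (≈-sym (x+c*0≈x (-ᶠ 1#) (V.vanishes f′∉B f∉B f≢f′)))
            (independent⇒zero (simple⇒pairs-independent M simple f≢f′)
              (codeword-+ (-ᶠ 1#) (V.codeword f∉B) (V.codeword f′∉B)) support f))
          where
          support : Supported (λ j → v f j +ᶠ (-ᶠ 1#) *ᶠ v f′ j) (⁅ f ⁆ ∪ ⁅ f′ ⁆)
          support {j} j∉ with j ∈? B
          ... | yes j∈B = x+[-1]*y≈0 (equal j∈B)
          ... | no  j∉B = 0+c*0≈0 (-ᶠ 1#)
            (V.vanishes f∉B j∉B (λ { refl → j∉ (p⊆p∪q ⁅ f′ ⁆ (x∈⁅x⁆ f)) }))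
            (V.vanishes f′∉B j∉B (λ { refl → j∉ (q⊆p∪q ⁅ f ⁆ ⁅ f′ ⁆ (x∈⁅x⁆ f′)) }))

      -- If every `v t` takes equal values at two elements of `B`, then by `rank-constant≤` the
      -- complement of this pair has rank at most `∣ B ∣ ∸ 1`, while cosimplicity forces full rank.
      cosimple⇒∣B∣≤ : Cosimple M → ∣ B ∣ ≤ q ^ ∣ ∁ B ∣
      cosimple⇒∣B∣≤ cosimple = ≮⇒≥ λ big →
        let H , H⊆B , 1<∣H∣ , constant =
              pigeonhole-family 1 (∁ B) color B (subst (_< ∣ B ∣) (sym (*-identityˡ _)) big)
            e , f , e≢f , e∈H , f∈H = 1<∣p∣⇒two-elements H 1<∣H∣
            P⊆H = ∪⊆ (⁅⁆⊆ e∈H) (⁅⁆⊆ f∈H)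
        in no-series-pair e≢f (H⊆B ∘ P⊆H) (λ t∈ → Constant-⊆ P⊆H (constant t∈))
        where
        no-series-pair : ∀ {e f} → e ≢ f → ⁅ e ⁆ ∪ ⁅ f ⁆ ⊆ B →
                         ¬ (∀ {t} → t ∈ ∁ B → Constant (color t) (⁅ e ⁆ ∪ ⁅ f ⁆))
        no-series-pair {e} {f} e≢f P⊆B constant = <⇒≱ (x≢y⇒1<∣⁅x⁆∪⁅y⁆∣ e≢f) (+-cancelʳ-≤ ∣ B ∩ ∁ P ∣ _ _ (begin
          ∣ P ∣ + ∣ B ∩ ∁ P ∣      ≤⟨ +-monoˡ-≤ _ (p⊆q⇒∣p∣≤∣q∣ (λ x∈ → x∈p∩q⁺ (P⊆B x∈ , x∈))) ⟩
          ∣ B ∩ P ∣ + ∣ B ∩ ∁ P ∣  ≡⟨ ∣p∩q∣+∣p∩∁q∣≡∣p∣ B P ⟩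
          ∣ B ∣                    ≡⟨ B-indep ⟨
          rank B                   ≤⟨ rank-mono ⊆⊤ ⟩
          rank ⊤                   ≤⟨ cosimple⇒no-series-pair M cosimple e≢f ⟩
          rank (∁ P)               ≤⟨ rank-mono ∁P⊆ ⟩
          rank ((B ∩ ∁ P) ∪ ∁ B)   ≤⟨ rank-constant≤ (p⊆p∪q ⁅ f ⁆ (x∈⁅x⁆ e)) id constant ⟩
          suc ∣ B ∩ ∁ P ∣          ∎))
          where
          open ≤-Reasoning
          P : Subset n
          P = ⁅ e ⁆ ∪ ⁅ f ⁆
          ∁P⊆ : ∁ P ⊆ (B ∩ ∁ P) ∪ ∁ B
          ∁P⊆ {x} x∈ with x ∈? B
          ... | yes x∈B = p⊆p∪q (∁ B) (x∈p∩q⁺ (x∈B , x∈))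
          ... | no  x∉B = q⊆p∪q (B ∩ ∁ P) (∁ B) (x∉p⇒x∈∁p x∉B)

      -- Taking `suc ℓ` columns and more than `k` elements in `H` compensates for the extra one in
      -- `rank-constant≤`, so that `corank-nullity⇒minor` applies to `(B ∩ ∁ H) ∪ T`.
      uniform⇒∣B∣≤ : ∀ k ℓ → Uniform k ℓ M → ℓ < ∣ ∁ B ∣ → ∣ B ∣ ≤ k * q ^ suc ℓ
      uniform⇒∣B∣≤ k ℓ uniform ℓ<∣∁B∣ = ≮⇒≥ λ big →
        let T , T⊆∁B , ∣T∣≡ = subset-of-size (suc ℓ) (∁ B) ℓ<∣∁B∣
            H , H⊆B , k<∣H∣ , constant =
              pigeonhole-family k T color B (subst (λ s → k * q ^ s < ∣ B ∣) (sym ∣T∣≡) big)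
            h , h∈H = 1≤∣p∣⇒Nonempty H (≤-trans (s≤s z≤n) k<∣H∣)
        in uniform (minor T⊆∁B ∣T∣≡ H⊆B k<∣H∣ (rank-constant≤ h∈H T⊆∁B constant))
        where
        minor : ∀ {T H} → T ⊆ ∁ B → ∣ T ∣ ≡ suc ℓ → H ⊆ B → k < ∣ H ∣ →
                rank ((B ∩ ∁ H) ∪ T) ≤ suc ∣ B ∩ ∁ H ∣ → HasMinorIsomorphicTo (U k k ⊕ U 0 ℓ) M
        minor {T} {H} T⊆∁B ∣T∣≡ H⊆B k<∣H∣ rankX≤ = corank-nullity⇒minor M X corank nullity
          where
          open ≤-Reasoning
          X : Subset n
          X = (B ∩ ∁ H) ∪ T
          corank : rank X + k ≤ rank ⊤
          corank = begin
            rank X + k               ≤⟨ +-monoˡ-≤ k rankX≤ ⟩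
            suc ∣ B ∩ ∁ H ∣ + k      ≡⟨ +-suc ∣ B ∩ ∁ H ∣ k ⟨
            ∣ B ∩ ∁ H ∣ + suc k      ≤⟨ +-monoʳ-≤ ∣ B ∩ ∁ H ∣ k<∣H∣ ⟩
            ∣ B ∩ ∁ H ∣ + ∣ H ∣      ≤⟨ +-monoʳ-≤ ∣ B ∩ ∁ H ∣ (p⊆q⇒∣p∣≤∣q∣ (λ x∈ → x∈p∩q⁺ (H⊆B x∈ , x∈))) ⟩
            ∣ B ∩ ∁ H ∣ + ∣ B ∩ H ∣  ≡⟨ +-comm ∣ B ∩ ∁ H ∣ _ ⟩
            ∣ B ∩ H ∣ + ∣ B ∩ ∁ H ∣  ≡⟨ ∣p∩q∣+∣p∩∁q∣≡∣p∣ B H ⟩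
            ∣ B ∣                    ≡⟨ B-indep ⟨
            rank B                   ≤⟨ rank-mono ⊆⊤ ⟩
            rank ⊤                   ∎
          nullity : rank X + ℓ ≤ ∣ X ∣
          nullity = begin
            rank X + ℓ               ≤⟨ +-monoˡ-≤ ℓ rankX≤ ⟩
            suc ∣ B ∩ ∁ H ∣ + ℓ      ≡⟨ +-suc ∣ B ∩ ∁ H ∣ ℓ ⟨
            ∣ B ∩ ∁ H ∣ + suc ℓ      ≡⟨ cong (∣ B ∩ ∁ H ∣ +_) ∣T∣≡ ⟨
            ∣ B ∩ ∁ H ∣ + ∣ T ∣      ≤⟨ ∣p∣+∣q∣≤∣p∪q∣ (B ∩ ∁ H) T (λ x∈ x∈T → x∈∁p⇒x∉p (T⊆∁B x∈T) (p∩q⊆p B _ x∈)) ⟩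
            ∣ X ∣                    ∎

    -- The bound adds up two cases. If `∣ ∁ B ∣ ≤ ℓ`, cosimplicity bounds `∣ B ∣` by `q ^ ℓ`;
    -- otherwise uniformity bounds `∣ B ∣` by `k * q ^ suc ℓ`, and simplicity then bounds `∣ ∁ B ∣`.
    size≤ : ∀ k ℓ → Simple M → Cosimple M → Uniform k ℓ M →
            n ≤ (q ^ ℓ + ℓ) + (k * q ^ suc ℓ + q ^ (k * q ^ suc ℓ))
    size≤ k ℓ simple cosimple uniform
      with B , _ , _ , B-indep , rank⊤≤ ← extend-to-basis M ⊆⊤ (⊥-independent M) = bound
      where
      open WithBasis B-indep rank⊤≤
      open ≤-Reasoning
      bound : n ≤ (q ^ ℓ + ℓ) + (k * q ^ suc ℓ + q ^ (k * q ^ suc ℓ))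
      bound with ℓ <? ∣ ∁ B ∣
      ... | yes ℓ<∣∁B∣ = let ∣B∣≤ = uniform⇒∣B∣≤ k ℓ uniform ℓ<∣∁B∣ in begin
        n                   ≡⟨ ∣p∣+∣∁p∣≡n B ⟨
        ∣ B ∣ + ∣ ∁ B ∣     ≤⟨ +-mono-≤ ∣B∣≤ (≤-trans (simple⇒∣∁B∣≤ simple) (^-monoʳ-≤ q {{q-nonZero}} ∣B∣≤)) ⟩
        k * q ^ suc ℓ + q ^ (k * q ^ suc ℓ)  ≤⟨ m≤n+m _ (q ^ ℓ + ℓ) ⟩
        _ ∎
      ... | no  ℓ≮∣∁B∣ = let ∣∁B∣≤ = ≮⇒≥ ℓ≮∣∁B∣ in begin
        n                   ≡⟨ ∣p∣+∣∁p∣≡n B ⟨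
        ∣ B ∣ + ∣ ∁ B ∣     ≤⟨ +-mono-≤ (≤-trans (cosimple⇒∣B∣≤ cosimple) (^-monoʳ-≤ q {{q-nonZero}} ∣∁B∣≤)) ∣∁B∣≤ ⟩
        q ^ ℓ + ℓ           ≤⟨ m≤m+n _ _ ⟩
        _ ∎

theorem1p1 : ∀ {c ℓ₁ ℓ₂ : Level} (k ℓ q : ℕ) → k ≥ 1 → ℓ ≥ 1 → PrimePower q →
    (F : HeytingField c ℓ₁ ℓ₂) → HasOrder F q →
    FinitelyManyUpToIsomorphism λ M →
    Simple M × Cosimple M × Representable F M × Uniform k ℓ M
theorem1p1 k ℓ q _ _ _ F order =
  -- The omitted bound is the one in `size≤`; it depends on `k`, `ℓ` and `q` but not on `M`.
  let matroids , complete = finitely-many-of-bounded-size _ in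
  matroids , λ { M (simple , cosimple , (_ , A , independent⇔) , uniform) →
    complete M (FiniteField.Represented.size≤ F order M A independent⇔ k ℓ simple cosimple uniform) }
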